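{- Let $p>3$ be prime, $\mathbb{F}=\mathbb{F}_{p^m}$, and $\Phi$ an irreducible root system of rank at least $2$. Let $S\subseteq\Phi$ be a subset of ${\mathrm{rank}}(\Phi)+1$ roots with $S^+=\Phi$. Then $X_S=E(\Phi,\mathbb{F})$.
   Context: Identify $\mathbb{F}$ with $\mathbb{F}_p[x]/(f)$ for a fixed irreducible $f$ of degree $m$; $\deg(t)$ for $t\in\mathbb{F}$ is the degree of its representative of degree $<m$. $E(\Phi,\mathbb{F})$ is the universal Chevalley group, generated by root elements $x_\alpha(t)$ ($\alpha\in\Phi$, $t\in\mathbb{F}$) subject to the Steinberg relations: $x_\alpha(t)x_\alpha(u)=x_\alpha(t+u)$; the Chevalley commutator formula $[x_\alpha(t),x_\beta(u)]=\prod_{i,j>0,\ i\alpha+j\beta\in\Phi}x_{i\alpha+j\beta}(C^{\alpha,\beta}_{ij}t^iu^j)$ for $\alpha+\beta\ne0$ with standard structure constants $C^{\alpha,\beta}_{ij}\in\{\pm1,\pm2,\pm3\}$; and $h_\alpha(t)h_\alpha(u)=h_\alpha(tu)$ where $h_\alpha(t)=n_\alpha(t)n_\alpha(-1)$, $n_\alpha(t)=x_\alpha(t)x_{ -\alpha}(-t^{ -1})x_\alpha(t)$. For $S\subseteq\Phi$, $X_S=\langle x_\alpha(t):\alpha\in S,\ t\in\mathbb{F},\ \deg(t)\le1\rangle$, and $S^+=\Phi\cap\{\sum_{\alpha\in S}n_\alpha\alpha:n_\alpha\in\mathbb{N}\}$. -}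

module Defs where

open import Data.Nat as ℕ using (ℕ; zero; suc; NonZero; _≤_)
open import Data.Nat.DivMod using (_mod_)
open import Data.Integer as ℤ using (ℤ; +_; -[1+_]; _/ℕ_)
open import Data.Fin as Fin using (Fin; toℕ)
open import Data.Vec as Vec using (Vec; []; _∷_; lookup; zipWith; replicate; init; last; toList)
open import Data.Vec.Properties using (≡-dec)
open import Data.List as List using (List; []; _∷_; _++_; concatMap)
open import Data.List.Relation.Unary.All using (All)
open import Data.Bool using (Bool; true; false; if_then_else_)
open import Data.Maybe using (Maybe; just; nothing)
open import Data.Product using (Σ; ∃; _×_; _,_)
open import Data.Sum using (_⊎_)
open import Function using (_∘_)
open import Function.Definitions using (Injective)
open import Relation.Nullary using (¬_; does)
open import Relation.Binary.PropositionalEquality using (_≡_; _≢_)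

ZVec : ℕ → Set
ZVec n = Vec ℤ n

_+v_ : ∀ {n} → ZVec n → ZVec n → ZVec n
_+v_ = zipWith ℤ._+_

_·v_ : ∀ {n} → ℤ → ZVec n → ZVec n
k ·v v = Vec.map (k ℤ.*_) v

-v_ : ∀ {n} → ZVec n → ZVec n
-v v = Vec.map ℤ.-_ v

0v : ∀ {n} → ZVec n
0v = replicate _ (+ 0)

_≟v_ : ∀ {n} (v w : ZVec n) → Relation.Nullary.Dec (v ≡ w)
_≟v_ = ≡-dec ℤ._≟_

sumℤ : ∀ {k} → (Fin k → ℤ) → ℤ
sumℤ {zero}  f = + 0
sumℤ {suc k} f = f Fin.zero ℤ.+ sumℤ (f ∘ Fin.suc)

sumV : ∀ {k n} → (Fin k → ZVec n) → ZVec n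
sumV {zero}  f = 0v
sumV {suc k} f = f Fin.zero +v sumV (f ∘ Fin.suc)

sumℕV : ∀ {k n} → (Fin k → ℕ) → (Fin k → ZVec n) → ZVec n
sumℕV c f = sumV (λ i → (+ c i) ·v f i)

bil : ∀ {n} → (Fin n → Fin n → ℤ) → ZVec n → ZVec n → ℤ
bil G v w = sumℤ (λ i → sumℤ (λ j → lookup v i ℤ.* (G i j ℤ.* lookup w j)))

record RootSystem (n : ℕ) : Set where
  field
    N        : ℕ
    root     : Fin N → ZVec n
    root-inj : Injective _≡_ _≡_ root
    G        : Fin n → Fin n → ℤ
    G-sym    : ∀ i j → G i j ≡ G j i
    G-posdef : ∀ (v : ZVec n) → v ≢ 0v → + 0 ℤ.< bil G v v
    nonzero  : ∀ a → root a ≢ 0v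
    -- Φ spans ℚ^n
    spans    : ∀ (v : ZVec n) → Σ ℤ λ d → d ≢ + 0 × Σ (Fin N → ℤ) λ c →
                 d ·v v ≡ sumV (λ a → c a ·v root a)
    cartan   : Fin N → Fin N → ℤ
    cartan-def : ∀ b a → cartan b a ℤ.* bil G (root a) (root a) ≡ + 2 ℤ.* bil G (root b) (root a)
    reflect  : ∀ a b → Σ (Fin N) λ c → root c ≡ root b +v (-v (cartan b a ·v root a))
    reduced  : ∀ a b (j k : ℤ) → k ≢ + 0 → k ·v root b ≡ j ·v root a →
                 root b ≡ root a ⊎ root b ≡ -v root a
    irreducible : ∀ (P : Fin N → Bool) →
                 (∀ a b → P a ≢ P b → bil G (root a) (root b) ≡ + 0) →
                 (∀ a → P a ≡ true) ⊎ (∀ a → P a ≡ false)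

module RS {n : ℕ} (R : RootSystem n) where
  open RootSystem R public

  _∈Φ : ZVec n → Set
  v ∈Φ = Σ (Fin N) λ a → root a ≡ v

  findRoot : ZVec n → Maybe (Fin N)
  findRoot v = go root
    where
    go : ∀ {k} → (Fin k → ZVec n) → Maybe (Fin k)
    go {zero}  r = nothing
    go {suc k} r = if does (r Fin.zero ≟v v) then just Fin.zero
                   else Data.Maybe.map Fin.suc (go (r ∘ Fin.suc))

  PosClosureIsΦ : (s : Fin (suc n) → Fin N) → Set
  PosClosureIsΦ s = ∀ (g : Fin N) → Σ (Fin (suc n) → ℕ) λ c →
                      root g ≡ sumℕV c (λ k → root (s k))

-- Chevalley basis {h_α, e_α} of the Lie algebra of type Φ:
--   [h, e_β] = β(h) e_β,  [e_α, e_{-α}] = h_α,  [e_α,e_β] = Nc α β e_{α+β}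
--   (if α+β ∈ Φ), 0 otherwise, with Nc α β = ±(r+1), r maximal with
--   β - rα ∈ Φ; required: antisymmetry and the Jacobi identity.
-- Elements of the Lie algebra are represented as (Cartan part, given by
-- its values on all roots; coefficients of the e_γ).

record LieElt (N : ℕ) : Set where
  constructor ⟨_,_⟩
  field
    cart : Fin N → ℤ
    coef : Fin N → ℤ

module LieAlg {n : ℕ} (R : RootSystem n) (Nc : ZVec n → ZVec n → ℤ) where
  open RS R

  _⊕_ : LieElt N → LieElt N → LieElt N
  ⟨ h , c ⟩ ⊕ ⟨ h' , c' ⟩ = ⟨ (λ d → h d ℤ.+ h' d) , (λ e → c e ℤ.+ c' e) ⟩

  br : Fin N → Fin N → LieElt N
  br b c = ⟨ (λ d → if does ((root b +v root c) ≟v 0v) then cartan d b else + 0)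
           , (λ e → if does (root e ≟v (root b +v root c)) then Nc (root b) (root c) else + 0) ⟩

  adE : Fin N → LieElt N → LieElt N
  adE a ⟨ h , c ⟩ =
    ⟨ (λ d → sumℤ (λ g → c g ℤ.* LieElt.cart (br a g) d))
    , (λ e → (if does (e Fin.≟ a) then ℤ.- h a else + 0)
             ℤ.+ sumℤ (λ g → c g ℤ.* LieElt.coef (br a g) e)) ⟩

  IsZero : LieElt N → Set
  IsZero ⟨ h , c ⟩ = (∀ d → h d ≡ + 0) × (∀ e → c e ≡ + 0)

record ChevalleyBasis {n : ℕ} (R : RootSystem n) : Set where
  open RS R
  field
    Nc : ZVec n → ZVec n → ℤ
    Nc-antisym : ∀ a b → (root a +v root b) ∈Φ → Nc (root b) (root a) ≡ ℤ.- Nc (root a) (root b)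
    Nc-value : ∀ a b → (root a +v root b) ∈Φ →
      Σ ℕ λ r → (∀ i → i ≤ r → (root b +v (-v ((+ i) ·v root a))) ∈Φ)
              × ¬ ((root b +v (-v ((+ suc r) ·v root a))) ∈Φ)
              × (Nc (root a) (root b) ≡ + suc r ⊎ Nc (root a) (root b) ≡ ℤ.- (+ suc r))
    jacobi : ∀ a b c → let open LieAlg R Nc in
      IsZero ((adE a (br b c) ⊕ adE b (br c a)) ⊕ adE c (br a b))

-- The field 𝔽 = 𝔽_p[x]/(f), f = x^m + fl_{m-1} x^{m-1} + ... + fl_0 monic.
-- An element is its representative of degree < m (coefficient vector).

module Field (p : ℕ) .{{_ : NonZero p}} (m : ℕ) (fl : Vec (Fin p) m) where

  _+p_ _*p_ : Fin p → Fin p → Fin p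
  a +p b = (toℕ a ℕ.+ toℕ b) mod p
  a *p b = (toℕ a ℕ.* toℕ b) mod p

  -p_ : Fin p → Fin p
  -p a = (p ℕ.∸ toℕ a) mod p

  0p 1p : Fin p
  0p = 0 mod p
  1p = 1 mod p

  𝔽 : Set
  𝔽 = Vec (Fin p) m

  _+F_ : 𝔽 → 𝔽 → 𝔽
  _+F_ = zipWith _+p_

  -F_ : 𝔽 → 𝔽
  -F_ = Vec.map -p_

  0F : 𝔽
  0F = replicate m 0p

  constF : Fin p → 𝔽
  constF c = go m
    where
    go : (k : ℕ) → Vec (Fin p) k
    go zero    = []
    go (suc k) = c ∷ replicate k 0p

  1F : 𝔽
  1F = constF 1p

  scal : Fin p → 𝔽 → 𝔽
  scal c = Vec.map (c *p_)

  mulX : ∀ {k} → Vec (Fin p) k → Vec (Fin p) k → Vec (Fin p) k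
  mulX {zero}  f v = []
  mulX {suc k} f v = zipWith _+p_ (0p ∷ init v) (Vec.map ((-p last v) *p_) f)

  -- Horner: t * u = (...((t_{m-1} u) x + t_{m-2} u) x + ...) + t_0 u
  _*F_ : 𝔽 → 𝔽 → 𝔽
  t *F u = Vec.foldr (λ _ → 𝔽) (λ c acc → mulX fl acc +F scal c u) 0F t

  _^F_ : 𝔽 → ℕ → 𝔽
  t ^F zero  = 1F
  t ^F suc k = t *F (t ^F k)

  ι : ℤ → 𝔽
  ι (+ k)      = constF (k mod p)
  ι (-[1+ k ]) = -F constF (suc k mod p)

  Deg≤1 : 𝔽 → Set
  Deg≤1 t = ∀ (i : Fin m) → 2 ≤ toℕ i → lookup t i ≡ 0p

-- polynomials over 𝔽_p as little-endian coefficient lists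
module Poly (p : ℕ) .{{_ : NonZero p}} where
  open Field p 0 []  using (_+p_; _*p_; 0p; 1p)

  addP : List (Fin p) → List (Fin p) → List (Fin p)
  addP [] q = q
  addP (a ∷ r) [] = a ∷ r
  addP (a ∷ r) (b ∷ q) = (a +p b) ∷ addP r q

  mulP : List (Fin p) → List (Fin p) → List (Fin p)
  mulP [] q = []
  mulP (a ∷ r) q = addP (List.map (a *p_) q) (0p ∷ mulP r q)

  monic : ∀ {k} → Vec (Fin p) k → List (Fin p)
  monic v = toList v ++ (1p ∷ [])

  IrreducibleMonic : ∀ {m} → Vec (Fin p) m → Set
  IrreducibleMonic fl = ∀ a b (g : Vec (Fin p) a) (h : Vec (Fin p) b) →
    1 ≤ a → 1 ≤ b → mulP (monic g) (monic h) ≢ monic fl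

-- The universal Chevalley group E(Φ,𝔽) by generators x_α(t) and the
-- Steinberg relations, as words modulo the generated congruence.

module Chevalley (p : ℕ) .{{_ : NonZero p}} (m : ℕ) (fl : Vec (Fin p) m)
                 {n : ℕ} (R : RootSystem n) (CB : ChevalleyBasis R) where
  open RS R
  open ChevalleyBasis CB using (Nc)
  open Field p m fl

  Gen : Set
  Gen = Fin N × 𝔽

  -- (false , g) = g,  (true , g) = g⁻¹
  Letter : Set
  Letter = Bool × Gen

  Word : Set
  Word = List Letter

  inv : Letter → Letter
  inv (true , g)  = false , g
  inv (false , g) = true , g

  x : Fin N → 𝔽 → Word
  x a t = (false , (a , t)) ∷ []

  x⁻¹ : Fin N → 𝔽 → Word
  x⁻¹ a t = (true , (a , t)) ∷ []

  -- M(r,s,i) * i! = N(r,s) N(r,r+s) ... N(r,(i-1)r+s)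
  Nprod : ZVec n → ZVec n → ℕ → ℤ
  Nprod r s zero    = + 1
  Nprod r s (suc i) = Nprod r s i ℤ.* Nc r (((+ i) ·v r) +v s)

  M : ZVec n → ZVec n → ℕ → ℤ
  M r s 0 = Nprod r s 0
  M r s 1 = Nprod r s 1
  M r s 2 = Nprod r s 2 /ℕ 2
  M r s _ = Nprod r s 3 /ℕ 6

  sgn : ℕ → ℤ → ℤ
  sgn zero    k = k
  sgn (suc j) k = ℤ.- sgn j k

  -- structure constants C^{α,β}_{ij} of the commutator formula
  -- [x_α(t),x_β(u)] = Π x_{iα+jβ}(C_ij t^i u^j), [g,h] = g⁻¹h⁻¹gh
  -- (Carter, Simple Groups of Lie Type, Thm 5.2.2, rewritten)
  C : ZVec n → ZVec n → ℕ → ℕ → ℤ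
  C α β 1 j = sgn j (M β α j)
  C α β i 1 = ℤ.- sgn i (M α β i)
  C α β 2 3 = ℤ.- ((Nc (α +v β) β ℤ.* Nc (α +v β) (α +v ((+ 2) ·v β))) /ℕ 6)
  C α β 3 2 = ℤ.- ((Nc (α +v β) α ℤ.* Nc (α +v β) (((+ 2) ·v α) +v β)) /ℕ 3)
  C α β _ _ = + 0

  pairs : List (ℕ × ℕ)
  pairs = (1 , 1) ∷ (2 , 1) ∷ (1 , 2) ∷ (3 , 1) ∷ (2 , 2) ∷ (1 , 3) ∷ (3 , 2) ∷ (2 , 3) ∷ []

  commProd : Fin N → Fin N → 𝔽 → 𝔽 → Word
  commProd a b t u = concatMap term pairs
    where
    term : ℕ × ℕ → Word
    term (i , j) with findRoot (((+ i) ·v root a) +v ((+ j) ·v root b))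
    ... | nothing = []
    ... | just g  = x g ((ι (C (root a) (root b) i j) *F (t ^F i)) *F (u ^F j))

  commW : Fin N → Fin N → 𝔽 → 𝔽 → Word
  commW a b t u = x⁻¹ a t ++ x⁻¹ b u ++ x a t ++ x b u

  -- n_α(t) and h_α(t), with ti = t⁻¹ and a' the index of -α
  nW : Fin N → Fin N → 𝔽 → 𝔽 → Word
  nW a a' t ti = x a t ++ x a' (-F ti) ++ x a t

  hW : Fin N → Fin N → 𝔽 → 𝔽 → Word
  hW a a' t ti = nW a a' t ti ++ nW a a' (-F 1F) (-F 1F)

  infix 4 _≈_
  data _≈_ : Word → Word → Set where
    ≈-refl  : ∀ {w} → w ≈ w
    ≈-sym   : ∀ {v w} → v ≈ w → w ≈ v
    ≈-trans : ∀ {u v w} → u ≈ v → v ≈ w → u ≈ w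
    ≈-cong  : ∀ {u u' v v'} → u ≈ u' → v ≈ v' → u ++ v ≈ u' ++ v'
    free    : ∀ l → l ∷ inv l ∷ [] ≈ []
    rel-add : ∀ a t u → x a t ++ x a u ≈ x a (t +F u)
    rel-comm : ∀ a b → root a +v root b ≢ 0v → ∀ t u → commW a b t u ≈ commProd a b t u
    rel-h   : ∀ a a' → root a' ≡ -v root a → ∀ t ti u ui w wi →
              t *F ti ≡ 1F → u *F ui ≡ 1F → w ≡ t *F u → w *F wi ≡ 1F →
              hW a a' t ti ++ hW a a' u ui ≈ hW a a' w wi

  -- X_S = E(Φ,𝔽): every generator x_α(t) of E(Φ,𝔽) is equal in E(Φ,𝔽)
  -- to a word in the x_β(u)^{±1} with β ∈ S and deg u ≤ 1.
  X-S≡E : (s : Fin (suc n) → Fin N) → Set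
  X-S≡E s = ∀ (a : Fin N) (t : 𝔽) → Σ Word λ w →
     All (λ l → Σ (Fin (suc n)) λ k → Data.Product.proj₁ (Data.Product.proj₂ l) ≡ s k
                × Deg≤1 (Data.Product.proj₂ (Data.Product.proj₂ l))) w
     × w ≈ x a t

{-# OPTIONS --safe #-}
-- For a subgroup H put V_α = {t : x_α(t) ∈ H}, an additive subgroup of 𝔽.  The key step is that
-- V_α V_β ⊆ V_{α+β} whenever α, β and α+β are roots.  Write f(t,u) for the commutator product of
-- x_α(t) and x_β(u).  Unless α and β are a short and a long root of G₂, its factors commute and those
-- other than the x_{α+β}-factor have odd total degree in (t,u), so f(t,u) f(-t,-u) is the square of the
-- x_{α+β}-factor.  In the remaining case, with α short, products of the f(±t,±u)^{±1} leave the fourth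
-- powers of the x_{α+β}- and x_{3α+β}-factors, and replacing t by 2t separates them as p does not
-- divide 24.  Peeling off summands s ∈ S with (γ,s) > 0 then shows that every V_γ contains all elements
-- of degree at most 1.  Since every root is a sum of two roots, the intersection of all V_γ is closed
-- under multiplication by x, so it is 𝔽.
module Submission where

open import Defs
open import Level using (0ℓ)
open import Algebra.Bundles using (Group; AbelianGroup)
import Algebra.Properties.Group
open import Data.Bool using (Bool; true; false; if_then_else_)
open import Data.Empty using (⊥; ⊥-elim)
open import Data.Fin as Fin using (Fin; toℕ)
import Data.Fin.Properties as Finₚ
open import Data.Integer as ℤ using (ℤ; +_; -[1+_]; 0ℤ; 1ℤ; -1ℤ; +<+; +≤+)
import Data.Integer.Properties as ℤₚ
open import Data.Integer.Tactic.RingSolver using (solve-∀)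
open import Data.List using (_++_; []; _∷_)
open import Data.List.Properties using (++-assoc; ++-identityʳ)
open import Data.List.Relation.Unary.All using (All; []; _∷_)
import Data.List.Relation.Unary.All.Properties as Allₚ
open import Data.Maybe as Maybe using (Maybe; just; nothing)
open import Data.Nat as ℕ using (ℕ; zero; suc; NonZero; _≤_; _<_; s≤s; z≤n)
open import Data.Nat.Coprimality using (prime⇒coprime; coprime-Bézout)
open import Data.Nat.DivMod using (_%_; _mod_; m%n<n; m<n⇒m%n≡m; %-distribˡ-+; %-distribˡ-*; n%n≡0)
open import Data.Nat.GCD using (module Bézout)
open import Data.Nat.Primality using (Prime)
import Data.Nat.Properties as ℕₚ
open import Data.Product using (Σ; ∃; ∃₂; _×_; _,_; proj₁; proj₂)
open import Data.Sum using (_⊎_; inj₁; inj₂; [_,_]′)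
open import Data.Vec as Vec using (Vec; []; _∷_; lookup; zipWith; replicate; init; last)
open import Data.Vec.Properties using (zipWith-assoc; zipWith-comm; zipWith-identityˡ; zipWith-identityʳ; zipWith-inverseˡ; zipWith-inverseʳ; lookup-zipWith; lookup-map; lookup-replicate; map-cong; map-id)
open import Function using (_∘_)
open import Function.Definitions using (Injective)
open import Relation.Binary.Definitions using (tri<; tri≈; tri>)
open import Relation.Binary.PropositionalEquality using (_≡_; _≢_; refl; sym; trans; cong; cong₂; subst; subst₂; isEquivalence; module ≡-Reasoning)
open import Relation.Nullary
open import Relation.Nullary.Decidable using (True; toWitness; _⊎-dec_; _×-dec_; ¬?; dec-true; dec-false; decidable-stable)

-- The obstacle is that a commutator places only a product of several root elements in H, while
-- nothing is known about the single factors at 2α+β and beyond; the factor at α+β must be isolated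
-- without them. Since V_α is an additive group, t may be replaced by -t or 2t inside it, and this
-- acts on the factor at iα+jβ only through the degrees i and j. What remains is a power of the
-- wanted factor, with exponent 2, or 24 = 8·4 - 4·2 in type G₂, where 8 = 2³ is the scaling of the
-- factor at 3α+β. The structure constant at α+β is ±(r+1) with r+1 at most 3. All these numbers are
-- prime to p, and every x_γ(t) satisfies x_γ(t)^p = 1, so Bézout recovers an element from its
-- power.
--
-- Which roots occur in rank two is not taken from a classification: every Cartan integer has
-- absolute value at most 3, and this bound excludes the unwanted combinations iα+jβ by a numerical
-- check on the Gram matrix.
--
-- Peeling keeps the parameter fixed because 1 has degree at most 1: the summand s is always used
-- with parameter 1.

private module ℤGroup = Algebra.Properties.Group (AbelianGroup.group ℤₚ.+-0-abelianGroup)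

-- Products in groups

module GroupLemmas (G : Group 0ℓ 0ℓ) where
  open Group G renaming (refl to ≈-refl; sym to ≈-sym; trans to ≈-trans)
  open import Algebra.Properties.Group G public
  open import Algebra.Properties.Monoid.Mult monoid public renaming (_×_ to _⊗_)
  open import Relation.Binary.Reasoning.Setoid (Group.setoid G)

  Commute : Carrier → Carrier → Set
  Commute a b = a ∙ b ≈ b ∙ a

  commute-∙ʳ : ∀ {a b c} → Commute a b → Commute a c → Commute a (b ∙ c)
  commute-∙ʳ {a} {b} {c} ab ac = begin
    a ∙ (b ∙ c)  ≈⟨ assoc a b c ⟨
    a ∙ b ∙ c    ≈⟨ ∙-congʳ ab ⟩
    b ∙ a ∙ c    ≈⟨ assoc b a c ⟩
    b ∙ (a ∙ c)  ≈⟨ ∙-congˡ ac ⟩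
    b ∙ (c ∙ a)  ≈⟨ assoc b c a ⟨
    b ∙ c ∙ a    ∎

  commute-ε : ∀ a → Commute a ε
  commute-ε a = ≈-trans (identityʳ a) (≈-sym (identityˡ a))

  commute-⁻¹ʳ : ∀ {a b} → Commute a b → Commute a (b ⁻¹)
  commute-⁻¹ʳ {a} {b} ab = ∙-cancelˡ b _ _ (begin
    b ∙ (a ∙ b ⁻¹)  ≈⟨ assoc b a _ ⟨
    b ∙ a ∙ b ⁻¹    ≈⟨ ∙-congʳ ab ⟨
    a ∙ b ∙ b ⁻¹    ≈⟨ //-rightDividesʳ b a ⟩
    a               ≈⟨ \\-leftDividesˡ b a ⟨
    b ∙ (b ⁻¹ ∙ a)  ∎)

  commute-×ʳ : ∀ {a b} k → Commute a b → Commute a (k ⊗ b)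
  commute-×ʳ {a} zero    ab = commute-ε a
  commute-×ʳ     (suc k) ab = commute-∙ʳ ab (commute-×ʳ k ab)

  interchange : ∀ {a b c d} → Commute b c → (a ∙ b) ∙ (c ∙ d) ≈ (a ∙ c) ∙ (b ∙ d)
  interchange {a} {b} {c} {d} bc = begin
    (a ∙ b) ∙ (c ∙ d)  ≈⟨ assoc a b _ ⟩
    a ∙ (b ∙ (c ∙ d))  ≈⟨ ∙-congˡ (assoc b c d) ⟨
    a ∙ (b ∙ c ∙ d)    ≈⟨ ∙-congˡ (∙-congʳ bc) ⟩
    a ∙ (c ∙ b ∙ d)    ≈⟨ ∙-congˡ (assoc c b d) ⟩
    a ∙ (c ∙ (b ∙ d))  ≈⟨ assoc a c _ ⟨
    (a ∙ c) ∙ (b ∙ d)  ∎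

  ×-distrib-commute : ∀ {a b} k → Commute a b → k ⊗ (a ∙ b) ≈ (k ⊗ a) ∙ (k ⊗ b)
  ×-distrib-commute zero    ab = ≈-sym (identityˡ ε)
  ×-distrib-commute {a} {b} (suc k) ab = begin
    (a ∙ b) ∙ k ⊗ (a ∙ b)          ≈⟨ ∙-congˡ (×-distrib-commute k ab) ⟩
    (a ∙ b) ∙ (k ⊗ a ∙ k ⊗ b)      ≈⟨ interchange (≈-sym (commute-sym-× k)) ⟩
    (a ∙ k ⊗ a) ∙ (b ∙ k ⊗ b)      ∎
    where
    commute-sym-× : ∀ k → Commute (k ⊗ a) b
    commute-sym-× k = ≈-sym (commute-×ʳ k (≈-sym ab))

  commutator⇒ : ∀ {a b c} → a ⁻¹ ∙ (b ⁻¹ ∙ (a ∙ b)) ≈ c → a ∙ b ≈ b ∙ a ∙ c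
  commutator⇒ {a} {b} {c} eq = begin
    a ∙ b                                    ≈⟨ \\-leftDividesˡ b _ ⟨
    b ∙ (b ⁻¹ ∙ (a ∙ b))                     ≈⟨ ∙-congˡ (\\-leftDividesˡ a _) ⟨
    b ∙ (a ∙ (a ⁻¹ ∙ (b ⁻¹ ∙ (a ∙ b))))      ≈⟨ assoc b a _ ⟨
    b ∙ a ∙ (a ⁻¹ ∙ (b ⁻¹ ∙ (a ∙ b)))        ≈⟨ ∙-congˡ eq ⟩
    b ∙ a ∙ c                                ∎

  cancel-inverse : ∀ {a b d d′} → Commute d b → d ∙ d′ ≈ ε → (a ∙ d) ∙ (b ∙ d′) ≈ a ∙ b
  cancel-inverse {a} {b} {d} {d′} db dd′ = begin
    (a ∙ d) ∙ (b ∙ d′)  ≈⟨ interchange db ⟩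
    (a ∙ b) ∙ (d ∙ d′)  ≈⟨ ∙-congˡ dd′ ⟩
    (a ∙ b) ∙ ε         ≈⟨ identityʳ _ ⟩
    a ∙ b               ∎

  -- In the application `a`, `b`, `c` are the factors at α+β, 2α+β, 3α+β, and `d` in `product` is
  -- the one at 3α+2β. Only `a` and `b` fail to commute; their commutator `e` also lies at 3α+2β and
  -- commutes with all three.
  module G₂Product {a b c e : Carrier}
    (ba : b ∙ a ≈ a ∙ b ∙ e) (ac : Commute a c) (bc : Commute b c)
    (ae : Commute a e) (be : Commute b e) (ce : Commute c e) where

    -- The two brackets carry inverse values of the second and the fourth factor. Moving the second
    -- `a` left across `b` costs exactly one `e`; then `b`, `b′` and `d`, `d′` cancel.
    product : ∀ {b′ d d′} → b ∙ b′ ≈ ε → d ∙ d′ ≈ ε → Commute c b′ →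
              Commute d a → Commute d b′ → Commute d c →
              (((a ∙ b) ∙ c) ∙ d) ∙ (((a ∙ b′) ∙ c) ∙ d′) ≈ ((a ∙ a) ∙ (c ∙ c)) ∙ e
    product {b′} {d} {d′} bb′ dd′ cb′ da db′ dc = begin
      (((a ∙ b) ∙ c) ∙ d) ∙ (((a ∙ b′) ∙ c) ∙ d′)
        ≈⟨ cancel-inverse (commute-∙ʳ (commute-∙ʳ da db′) dc) dd′ ⟩
      ((a ∙ b) ∙ c) ∙ ((a ∙ b′) ∙ c)
        ≈⟨ interchange (commute-∙ʳ (≈-sym ac) cb′) ⟩
      ((a ∙ b) ∙ (a ∙ b′)) ∙ (c ∙ c)
        ≈⟨ ∙-congʳ abab′ ⟩
      (a ∙ a ∙ e) ∙ (c ∙ c)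
        ≈⟨ assoc _ _ _ ⟩
      (a ∙ a) ∙ (e ∙ (c ∙ c))
        ≈⟨ ∙-congˡ (commute-∙ʳ (≈-sym ce) (≈-sym ce)) ⟩
      (a ∙ a) ∙ (c ∙ c ∙ e)
        ≈⟨ assoc _ _ _ ⟨
      ((a ∙ a) ∙ (c ∙ c)) ∙ e ∎
      where
      abab′ : (a ∙ b) ∙ (a ∙ b′) ≈ a ∙ a ∙ e
      abab′ = begin
        (a ∙ b) ∙ (a ∙ b′)      ≈⟨ assoc _ _ _ ⟩
        a ∙ (b ∙ (a ∙ b′))      ≈⟨ ∙-congˡ (assoc _ _ _) ⟨
        a ∙ (b ∙ a ∙ b′)        ≈⟨ ∙-congˡ (∙-congʳ ba) ⟩
        a ∙ (a ∙ b ∙ e ∙ b′)    ≈⟨ ∙-congˡ (∙-congʳ (assoc a b e)) ⟩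
        a ∙ (a ∙ (b ∙ e) ∙ b′)  ≈⟨ ∙-congˡ (∙-congʳ (∙-congˡ be)) ⟩
        a ∙ (a ∙ (e ∙ b) ∙ b′)  ≈⟨ ∙-congˡ (∙-congʳ (assoc a e b)) ⟨
        a ∙ (a ∙ e ∙ b ∙ b′)    ≈⟨ ∙-congˡ (assoc _ b b′) ⟩
        a ∙ (a ∙ e ∙ (b ∙ b′))  ≈⟨ ∙-congˡ (≈-trans (∙-congˡ bb′) (identityʳ _)) ⟩
        a ∙ (a ∙ e)             ≈⟨ assoc a a e ⟨
        a ∙ a ∙ e               ∎

    -- Inverting both elements preserves a commutator that commutes with them. So `product` applies
    -- to the inverses with the same `e`, and a quotient of the two results removes `e`.
    ba-inverse : b ⁻¹ ∙ a ⁻¹ ≈ a ⁻¹ ∙ b ⁻¹ ∙ e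
    ba-inverse = begin
      b ⁻¹ ∙ a ⁻¹          ≈⟨ ⁻¹-anti-homo-∙ a b ⟨
      (a ∙ b) ⁻¹           ≈⟨ ⁻¹-cong (x≈z//y _ _ _ (≈-sym ba)) ⟩
      (b ∙ a ∙ e ⁻¹) ⁻¹    ≈⟨ ⁻¹-anti-homo-// (b ∙ a) e ⟩
      e ∙ (b ∙ a) ⁻¹       ≈⟨ ∙-congˡ (⁻¹-anti-homo-∙ b a) ⟩
      e ∙ (a ⁻¹ ∙ b ⁻¹)    ≈⟨ commute-∙ʳ (commute-⁻¹ʳ (≈-sym ae)) (commute-⁻¹ʳ (≈-sym be)) ⟩
      a ⁻¹ ∙ b ⁻¹ ∙ e      ∎

  squares-inverse : ∀ {a c} → Commute a c → (a ⁻¹ ∙ a ⁻¹) ∙ (c ⁻¹ ∙ c ⁻¹) ≈ ((a ∙ a) ∙ (c ∙ c)) ⁻¹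
  squares-inverse {a} {c} ac = begin
    (a ⁻¹ ∙ a ⁻¹) ∙ (c ⁻¹ ∙ c ⁻¹)  ≈⟨ ∙-cong (⁻¹-anti-homo-∙ a a) (⁻¹-anti-homo-∙ c c) ⟨
    (a ∙ a) ⁻¹ ∙ (c ∙ c) ⁻¹        ≈⟨ ⁻¹-anti-homo-∙ _ _ ⟨
    ((c ∙ c) ∙ (a ∙ a)) ⁻¹         ≈⟨ ⁻¹-cong (commute-∙ʳ cca cca) ⟩
    ((a ∙ a) ∙ (c ∙ c)) ⁻¹         ∎
    where
    cca : Commute (c ∙ c) a
    cca = ≈-sym (commute-∙ʳ ac ac)

  quotient-square : ∀ {l e} → Commute l e → (l ∙ e) ∙ (l ⁻¹ ∙ e) ⁻¹ ≈ l ∙ l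
  quotient-square {l} {e} le = begin
    (l ∙ e) ∙ (l ⁻¹ ∙ e) ⁻¹        ≈⟨ ∙-congˡ (⁻¹-anti-homo-∙ _ e) ⟩
    (l ∙ e) ∙ (e ⁻¹ ∙ l ⁻¹ ⁻¹)     ≈⟨ assoc _ _ _ ⟨
    l ∙ e ∙ e ⁻¹ ∙ l ⁻¹ ⁻¹         ≈⟨ ∙-cong (//-rightDividesʳ e l) (⁻¹-involutive l) ⟩
    l ∙ l                          ∎

  fourth-powers : ∀ {a c} → Commute a c →
                  ((a ∙ a) ∙ (c ∙ c)) ∙ ((a ∙ a) ∙ (c ∙ c)) ≈ (4 ⊗ a) ∙ (4 ⊗ c)
  fourth-powers {a} {c} ac = begin
    ((a ∙ a) ∙ (c ∙ c)) ∙ ((a ∙ a) ∙ (c ∙ c))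
      ≈⟨ interchange (commute-∙ʳ cca cca) ⟩
    ((a ∙ a) ∙ (a ∙ a)) ∙ ((c ∙ c) ∙ (c ∙ c))
      ≈⟨ ∙-cong (quad a) (quad c) ⟩
    (4 ⊗ a) ∙ (4 ⊗ c) ∎
    where
    cca : Commute (c ∙ c) a
    cca = ≈-sym (commute-∙ʳ ac ac)
    quad : ∀ x → (x ∙ x) ∙ (x ∙ x) ≈ 4 ⊗ x
    quad x = ≈-trans (assoc _ _ _) (∙-congˡ (∙-congˡ (∙-congˡ (≈-sym (identityʳ x)))))

  -- Here 2 and 8 are the exponents that t ↦ 2t produces on parts of degree 1 and 3 in t. The eighth
  -- power brings the exponent of `c` to 32 on both sides, and 32 - 8 = 24 remains on `a`.
  eliminate : ∀ {a c} → Commute a c →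
              (8 ⊗ (4 ⊗ a ∙ 4 ⊗ c)) ∙ (4 ⊗ (2 ⊗ a) ∙ 4 ⊗ (8 ⊗ c)) ⁻¹ ≈ 24 ⊗ a
  eliminate {a} {c} ac = begin
    (8 ⊗ (4 ⊗ a ∙ 4 ⊗ c)) ∙ (4 ⊗ (2 ⊗ a) ∙ 4 ⊗ (8 ⊗ c)) ⁻¹
      ≈⟨ ∙-cong (≈-trans (×-distrib-commute 8 (commute-×ʳ 4 (≈-sym (commute-×ʳ 4 (≈-sym ac)))))
                       (∙-cong (×-assocˡ a 8 4) (×-assocˡ c 8 4)))
                (⁻¹-cong (∙-cong (×-assocˡ a 4 2) (×-assocˡ c 4 8))) ⟩
    (32 ⊗ a ∙ 32 ⊗ c) ∙ (8 ⊗ a ∙ 32 ⊗ c) ⁻¹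
      ≈⟨ ∙-congˡ (⁻¹-anti-homo-∙ _ _) ⟩
    (32 ⊗ a ∙ 32 ⊗ c) ∙ ((32 ⊗ c) ⁻¹ ∙ (8 ⊗ a) ⁻¹)
      ≈⟨ assoc _ _ _ ⟨
    32 ⊗ a ∙ 32 ⊗ c ∙ (32 ⊗ c) ⁻¹ ∙ (8 ⊗ a) ⁻¹
      ≈⟨ ∙-congʳ (//-rightDividesʳ (32 ⊗ c) (32 ⊗ a)) ⟩
    32 ⊗ a ∙ (8 ⊗ a) ⁻¹
      ≈⟨ ∙-congʳ (×-homo-+ a 24 8) ⟩
    24 ⊗ a ∙ 8 ⊗ a ∙ (8 ⊗ a) ⁻¹
      ≈⟨ //-rightDividesʳ (8 ⊗ a) (24 ⊗ a) ⟩
    24 ⊗ a ∎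

  record IsSubgroup (P : Carrier → Set) : Set where
    field
      respects : ∀ {a b} → a ≈ b → P a → P b
      ε∈   : P ε
      ∙∈   : ∀ {a b} → P a → P b → P (a ∙ b)
      ⁻¹∈  : ∀ {a} → P a → P (a ⁻¹)

    ×∈ : ∀ {a} k → P a → P (k ⊗ a)
    ×∈ zero    a∈ = ε∈
    ×∈ (suc k) a∈ = ∙∈ a∈ (×∈ k a∈)

    ×-torsion : ∀ {a p} → p ⊗ a ≈ ε → ∀ k → (k ℕ.* p) ⊗ a ≈ ε
    ×-torsion {a} {p} pa zero    = ≈-refl
    ×-torsion {a} {p} pa (suc k) = begin
      (p ℕ.+ k ℕ.* p) ⊗ a        ≈⟨ ×-homo-+ a p (k ℕ.* p) ⟩
      p ⊗ a ∙ (k ℕ.* p) ⊗ a      ≈⟨ ∙-cong pa (×-torsion pa k) ⟩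
      ε ∙ ε                      ≈⟨ identityˡ ε ⟩
      ε                          ∎

    -- `k` is prime to `p`, so Bézout writes 1 as a combination of the two and makes `a` a power of
    -- its `k`-th power. Over ℕ the two signs of the combination are separate cases, one of which
    -- needs an inverse.
    ×-cancel : ∀ {a p} → Prime p → p ⊗ a ≈ ε → ∀ k → .{{NonZero k}} → k < p → P (k ⊗ a) → P a
    ×-cancel {a} {p} pr pa k k<p ka∈ with coprime-Bézout (prime⇒coprime pr k<p)
    ... | Bézout.+- x y eq = respects (≈-sym (inverseˡ-unique a _ (begin
        a ∙ y ⊗ (k ⊗ a)        ≈⟨ ∙-congˡ (×-assocˡ a y k) ⟩
        (1 ℕ.+ y ℕ.* k) ⊗ a    ≈⟨ ×-congˡ eq ⟩
        (x ℕ.* p) ⊗ a          ≈⟨ ×-torsion pa x ⟩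
        ε                      ∎))) (⁻¹∈ (×∈ y ka∈))
    ... | Bézout.-+ x y eq = respects (begin
        y ⊗ (k ⊗ a)            ≈⟨ ×-assocˡ a y k ⟩
        (y ℕ.* k) ⊗ a          ≈⟨ ×-congˡ eq ⟨
        (1 ℕ.+ x ℕ.* p) ⊗ a    ≈⟨ ∙-congˡ (×-torsion pa x) ⟩
        a ∙ ε                  ≈⟨ identityʳ a ⟩
        a                      ∎) (×∈ y ka∈)

-- Arithmetic of 𝔽 = 𝔽_p[x]/(f)

module FieldLemmas (p : ℕ) .{{_ : NonZero p}} (m : ℕ) (fl : Vec (Fin p) m) where
  open Field p m fl
  open ≡-Reasoning

  [_] : ℕ → Fin p
  [ k ] = k mod p

  toℕ-[] : ∀ k → toℕ [ k ] ≡ k % p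
  toℕ-[] k = Finₚ.toℕ-fromℕ< (m%n<n k p)

  -- Matching on this replaces residues by classes of natural numbers, so that each ring law of
  -- `Fin p` reduces to the law of ℕ through `+p-[]` and `*p-[]`.
  []-surjective : ∀ a → ∃ λ k → a ≡ [ k ]
  []-surjective a = toℕ a , sym (Finₚ.toℕ-injective (trans (toℕ-[] (toℕ a)) (m<n⇒m%n≡m (Finₚ.toℕ<n a))))

  []-cong-% : ∀ {j k} → j % p ≡ k % p → [ j ] ≡ [ k ]
  []-cong-% {j} {k} eq = Finₚ.toℕ-injective (trans (toℕ-[] j) (trans eq (sym (toℕ-[] k))))

  +p-[] : ∀ j k → [ j ] +p [ k ] ≡ [ j ℕ.+ k ]
  +p-[] j k = []-cong-% (trans (cong₂ (λ a b → (a ℕ.+ b) % p) (toℕ-[] j) (toℕ-[] k)) (sym (%-distribˡ-+ j k p)))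

  *p-[] : ∀ j k → [ j ] *p [ k ] ≡ [ j ℕ.* k ]
  *p-[] j k = []-cong-% (trans (cong₂ (λ a b → (a ℕ.* b) % p) (toℕ-[] j) (toℕ-[] k)) (sym (%-distribˡ-* j k p)))

  +p-comm : ∀ a b → a +p b ≡ b +p a
  +p-comm a b = cong [_] (ℕₚ.+-comm (toℕ a) (toℕ b))

  *p-comm : ∀ a b → a *p b ≡ b *p a
  *p-comm a b = cong [_] (ℕₚ.*-comm (toℕ a) (toℕ b))

  +p-assoc : ∀ a b c → (a +p b) +p c ≡ a +p (b +p c)
  +p-assoc a b c with []-surjective a | []-surjective b | []-surjective c
  ... | i , refl | j , refl | k , refl = begin
    ([ i ] +p [ j ]) +p [ k ]  ≡⟨ cong (_+p [ k ]) (+p-[] i j) ⟩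
    [ i ℕ.+ j ] +p [ k ]       ≡⟨ +p-[] (i ℕ.+ j) k ⟩
    [ i ℕ.+ j ℕ.+ k ]          ≡⟨ cong [_] (ℕₚ.+-assoc i j k) ⟩
    [ i ℕ.+ (j ℕ.+ k) ]        ≡⟨ +p-[] i (j ℕ.+ k) ⟨
    [ i ] +p [ j ℕ.+ k ]       ≡⟨ cong ([ i ] +p_) (+p-[] j k) ⟨
    [ i ] +p ([ j ] +p [ k ])  ∎

  *p-assoc : ∀ a b c → (a *p b) *p c ≡ a *p (b *p c)
  *p-assoc a b c with []-surjective a | []-surjective b | []-surjective c
  ... | i , refl | j , refl | k , refl = begin
    ([ i ] *p [ j ]) *p [ k ]  ≡⟨ cong (_*p [ k ]) (*p-[] i j) ⟩
    [ i ℕ.* j ] *p [ k ]       ≡⟨ *p-[] (i ℕ.* j) k ⟩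
    [ i ℕ.* j ℕ.* k ]          ≡⟨ cong [_] (ℕₚ.*-assoc i j k) ⟩
    [ i ℕ.* (j ℕ.* k) ]        ≡⟨ *p-[] i (j ℕ.* k) ⟨
    [ i ] *p [ j ℕ.* k ]       ≡⟨ cong ([ i ] *p_) (*p-[] j k) ⟨
    [ i ] *p ([ j ] *p [ k ])  ∎

  *p-distribˡ : ∀ a b c → a *p (b +p c) ≡ (a *p b) +p (a *p c)
  *p-distribˡ a b c with []-surjective a | []-surjective b | []-surjective c
  ... | i , refl | j , refl | k , refl = begin
    [ i ] *p ([ j ] +p [ k ])               ≡⟨ cong ([ i ] *p_) (+p-[] j k) ⟩
    [ i ] *p [ j ℕ.+ k ]                    ≡⟨ *p-[] i (j ℕ.+ k) ⟩
    [ i ℕ.* (j ℕ.+ k) ]                     ≡⟨ cong [_] (ℕₚ.*-distribˡ-+ i j k) ⟩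
    [ i ℕ.* j ℕ.+ i ℕ.* k ]                 ≡⟨ +p-[] (i ℕ.* j) (i ℕ.* k) ⟨
    [ i ℕ.* j ] +p [ i ℕ.* k ]              ≡⟨ cong₂ _+p_ (*p-[] i j) (*p-[] i k) ⟨
    ([ i ] *p [ j ]) +p ([ i ] *p [ k ])    ∎

  *p-distribʳ : ∀ a b c → (b +p c) *p a ≡ (b *p a) +p (c *p a)
  *p-distribʳ a b c = begin
    (b +p c) *p a         ≡⟨ *p-comm (b +p c) a ⟩
    a *p (b +p c)         ≡⟨ *p-distribˡ a b c ⟩
    (a *p b) +p (a *p c)  ≡⟨ cong₂ _+p_ (*p-comm a b) (*p-comm a c) ⟩
    (b *p a) +p (c *p a)  ∎

  +p-identityˡ : ∀ a → 0p +p a ≡ a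
  +p-identityˡ a with []-surjective a
  ... | k , refl = +p-[] 0 k

  +p-identityʳ : ∀ a → a +p 0p ≡ a
  +p-identityʳ a = trans (+p-comm a 0p) (+p-identityˡ a)

  *p-identityˡ : ∀ a → 1p *p a ≡ a
  *p-identityˡ a with []-surjective a
  ... | k , refl = trans (*p-[] 1 k) (cong [_] (ℕₚ.*-identityˡ k))

  *p-zeroˡ : ∀ a → 0p *p a ≡ 0p
  *p-zeroˡ a with []-surjective a
  ... | k , refl = *p-[] 0 k

  *p-zeroʳ : ∀ a → a *p 0p ≡ 0p
  *p-zeroʳ a = trans (*p-comm a 0p) (*p-zeroˡ a)

  [p]≡0p : [ p ] ≡ 0p
  [p]≡0p = []-cong-% (trans (n%n≡0 p) (sym (m<n⇒m%n≡m (ℕ.>-nonZero⁻¹ p))))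

  -p-inverseʳ : ∀ a → a +p (-p a) ≡ 0p
  -p-inverseʳ a with []-surjective a
  ... | k , refl = begin
    [ k ] +p [ p ℕ.∸ toℕ [ k ] ]             ≡⟨ cong (_+p [ p ℕ.∸ toℕ [ k ] ]) (sym (Finₚ.toℕ-injective (trans (toℕ-[] (toℕ [ k ])) (m<n⇒m%n≡m (Finₚ.toℕ<n [ k ]))))) ⟩
    [ toℕ [ k ] ] +p [ p ℕ.∸ toℕ [ k ] ]     ≡⟨ +p-[] (toℕ [ k ]) (p ℕ.∸ toℕ [ k ]) ⟩
    [ toℕ [ k ] ℕ.+ (p ℕ.∸ toℕ [ k ]) ]      ≡⟨ cong [_] (ℕₚ.m+[n∸m]≡n (ℕₚ.<⇒≤ (Finₚ.toℕ<n [ k ]))) ⟩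
    [ p ]                                    ≡⟨ [p]≡0p ⟩
    0p                                       ∎

  -p-inverseˡ : ∀ a → (-p a) +p a ≡ 0p
  -p-inverseˡ a = trans (+p-comm (-p a) a) (-p-inverseʳ a)

  𝔽p^ : ℕ → AbelianGroup 0ℓ 0ℓ
  𝔽p^ k = record
    { Carrier = Vec (Fin p) k
    ; _≈_ = _≡_
    ; _∙_ = zipWith _+p_
    ; ε = replicate k 0p
    ; _⁻¹ = Vec.map -p_
    ; isAbelianGroup = record
      { isGroup = record
        { isMonoid = record
          { isSemigroup = record
            { isMagma = record { isEquivalence = isEquivalence ; ∙-cong = cong₂ (zipWith _+p_) }
            ; assoc = zipWith-assoc +p-assoc }
          ; identity = zipWith-identityˡ +p-identityˡ , zipWith-identityʳ +p-identityʳ }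
        ; inverse = zipWith-inverseˡ -p-inverseˡ , zipWith-inverseʳ -p-inverseʳ
        ; ⁻¹-cong = cong (Vec.map -p_) }
      ; comm = zipWith-comm +p-comm }
    }

  module _ {k : ℕ} where
    open AbelianGroup (𝔽p^ k) public using ()
      renaming (identityˡ to +-identityˡ; identityʳ to +-identityʳ; inverseʳ to -‿inverseʳ)
    open import Algebra.Properties.CommutativeSemigroup (AbelianGroup.commutativeSemigroup (𝔽p^ k)) public
      using (interchange)
    open import Algebra.Properties.Group (AbelianGroup.group (𝔽p^ k)) public
      using (inverseʳ-unique; identityʳ-unique; ⁻¹-involutive)

  _⊞_ : ∀ {k} → Vec (Fin p) k → Vec (Fin p) k → Vec (Fin p) k
  _⊞_ = zipWith _+p_

  _⊙_ : ∀ {k} → Fin p → Vec (Fin p) k → Vec (Fin p) k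
  c ⊙ v = Vec.map (c *p_) v

  𝟎 : ∀ {k} → Vec (Fin p) k
  𝟎 = replicate _ 0p

  ⊙-distribˡ : ∀ {k} c (u v : Vec (Fin p) k) → c ⊙ (u ⊞ v) ≡ (c ⊙ u) ⊞ (c ⊙ v)
  ⊙-distribˡ c []      []      = refl
  ⊙-distribˡ c (a ∷ u) (b ∷ v) = cong₂ _∷_ (*p-distribˡ c a b) (⊙-distribˡ c u v)

  ⊙-distribʳ : ∀ {k} c d (v : Vec (Fin p) k) → (c +p d) ⊙ v ≡ (c ⊙ v) ⊞ (d ⊙ v)
  ⊙-distribʳ c d []      = refl
  ⊙-distribʳ c d (a ∷ v) = cong₂ _∷_ (*p-distribʳ a c d) (⊙-distribʳ c d v)

  ⊙-assoc : ∀ {k} c d (v : Vec (Fin p) k) → (c *p d) ⊙ v ≡ c ⊙ (d ⊙ v)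
  ⊙-assoc c d []      = refl
  ⊙-assoc c d (a ∷ v) = cong₂ _∷_ (*p-assoc c d a) (⊙-assoc c d v)

  ⊙-comm : ∀ {k} c d (v : Vec (Fin p) k) → c ⊙ (d ⊙ v) ≡ d ⊙ (c ⊙ v)
  ⊙-comm c d v = trans (sym (⊙-assoc c d v)) (trans (cong (_⊙ v) (*p-comm c d)) (⊙-assoc d c v))

  ⊙-identity : ∀ {k} (v : Vec (Fin p) k) → 1p ⊙ v ≡ v
  ⊙-identity v = trans (map-cong *p-identityˡ v) (map-id v)

  ⊙-zeroˡ : ∀ {k} (v : Vec (Fin p) k) → 0p ⊙ v ≡ 𝟎
  ⊙-zeroˡ []      = refl
  ⊙-zeroˡ (a ∷ v) = cong₂ _∷_ (*p-zeroˡ a) (⊙-zeroˡ v)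

  ⊙-zeroʳ : ∀ {k} c → c ⊙ 𝟎 {k} ≡ 𝟎
  ⊙-zeroʳ {zero}  c = refl
  ⊙-zeroʳ {suc k} c = cong₂ _∷_ (*p-zeroʳ c) (⊙-zeroʳ c)

  module Additive {j k} (φ : Vec (Fin p) j → Vec (Fin p) k) (φ-⊞ : ∀ u v → φ (u ⊞ v) ≡ φ u ⊞ φ v) where
    φ-𝟎 : φ 𝟎 ≡ 𝟎
    φ-𝟎 = identityʳ-unique (φ 𝟎) (φ 𝟎) (trans (sym (φ-⊞ 𝟎 𝟎)) (cong φ (+-identityˡ 𝟎)))

    φ-neg : ∀ u → φ (Vec.map -p_ u) ≡ Vec.map -p_ (φ u)
    φ-neg u = inverseʳ-unique (φ u) _ (trans (sym (φ-⊞ u _)) (trans (cong φ (-‿inverseʳ u)) φ-𝟎))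

  -p-+p : ∀ a b → -p (a +p b) ≡ (-p a) +p (-p b)
  -- Uniqueness of inverses is at hand for groups of vectors, so scalars are treated as vectors of
  -- length one.
  -p-+p a b = sym (Vec-head (inverseʳ-unique ((a +p b) ∷ []) (((-p a) +p (-p b)) ∷ []) (cong (_∷ []) sum)))
    where
    Vec-head : ∀ {a b : Fin p} → _≡_ {A = Vec (Fin p) 1} (a ∷ []) (b ∷ []) → a ≡ b
    Vec-head refl = refl
    sum : (a +p b) +p ((-p a) +p (-p b)) ≡ 0p
    sum = begin
      (a +p b) +p ((-p a) +p (-p b))   ≡⟨ cong (_+p ((-p a) +p (-p b))) (+p-comm a b) ⟩
      (b +p a) +p ((-p a) +p (-p b))   ≡⟨ +p-assoc b a _ ⟩
      b +p (a +p ((-p a) +p (-p b)))   ≡⟨ cong (b +p_) (+p-assoc a (-p a) (-p b)) ⟨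
      b +p ((a +p (-p a)) +p (-p b))   ≡⟨ cong (λ z → b +p (z +p (-p b))) (-p-inverseʳ a) ⟩
      b +p (0p +p (-p b))              ≡⟨ cong (b +p_) (+p-identityˡ (-p b)) ⟩
      b +p (-p b)                      ≡⟨ -p-inverseʳ b ⟩
      0p                               ∎

  -p-*p : ∀ c a → -p (c *p a) ≡ c *p (-p a)
  -p-*p c a = sym (begin
    c *p (-p a)                                    ≡⟨ +p-identityˡ _ ⟨
    0p +p (c *p (-p a))                            ≡⟨ cong (_+p (c *p (-p a))) (-p-inverseˡ (c *p a)) ⟨
    ((-p (c *p a)) +p (c *p a)) +p (c *p (-p a))   ≡⟨ +p-assoc (-p (c *p a)) _ _ ⟩
    (-p (c *p a)) +p ((c *p a) +p (c *p (-p a)))   ≡⟨ cong ((-p (c *p a)) +p_) (*p-distribˡ c a (-p a)) ⟨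
    (-p (c *p a)) +p (c *p (a +p (-p a)))          ≡⟨ cong (λ z → (-p (c *p a)) +p (c *p z)) (-p-inverseʳ a) ⟩
    (-p (c *p a)) +p (c *p 0p)                     ≡⟨ cong ((-p (c *p a)) +p_) (*p-zeroʳ c) ⟩
    (-p (c *p a)) +p 0p                            ≡⟨ +p-identityʳ _ ⟩
    -p (c *p a)                                    ∎)

  init-last-⊞ : ∀ {k} (u v : Vec (Fin p) (suc k)) →
    init (u ⊞ v) ≡ init u ⊞ init v × last (u ⊞ v) ≡ last u +p last v
  init-last-⊞ {zero}  (a ∷ []) (b ∷ []) = refl , refl
  init-last-⊞ {suc k} (a ∷ u) (b ∷ v) with init-last-⊞ u v
  ... | i , l = cong (_ ∷_) i , l

  init-last-⊙ : ∀ {k} c (v : Vec (Fin p) (suc k)) →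
    init (c ⊙ v) ≡ c ⊙ init v × last (c ⊙ v) ≡ c *p last v
  init-last-⊙ {zero}  c (a ∷ []) = refl , refl
  init-last-⊙ {suc k} c (a ∷ v) with init-last-⊙ c v
  ... | i , l = cong (_ ∷_) i , l

  mulX-⊞ : ∀ {k} (f u v : Vec (Fin p) k) → mulX f (u ⊞ v) ≡ mulX f u ⊞ mulX f v
  mulX-⊞ {zero}  f u v = refl
  mulX-⊞ {suc k} f u v = begin
    (0p ∷ init (u ⊞ v)) ⊞ ((-p last (u ⊞ v)) ⊙ f)
      ≡⟨ cong₂ (λ i l → (0p ∷ i) ⊞ ((-p l) ⊙ f)) (proj₁ (init-last-⊞ u v)) (proj₂ (init-last-⊞ u v)) ⟩
    (0p ∷ (init u ⊞ init v)) ⊞ ((-p (last u +p last v)) ⊙ f)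
      ≡⟨ cong₂ _⊞_ (cong (_∷ (init u ⊞ init v)) (sym (+p-identityˡ 0p)))
           (trans (cong (_⊙ f) (-p-+p (last u) (last v))) (⊙-distribʳ (-p last u) (-p last v) f)) ⟩
    ((0p ∷ init u) ⊞ (0p ∷ init v)) ⊞ (((-p last u) ⊙ f) ⊞ ((-p last v) ⊙ f))
      ≡⟨ interchange (0p ∷ init u) (0p ∷ init v) ((-p last u) ⊙ f) ((-p last v) ⊙ f) ⟩
    mulX f u ⊞ mulX f v ∎

  mulX-⊙ : ∀ {k} (f : Vec (Fin p) k) c v → mulX f (c ⊙ v) ≡ c ⊙ mulX f v
  mulX-⊙ {zero}  f c v = refl
  mulX-⊙ {suc k} f c v = begin
    (0p ∷ init (c ⊙ v)) ⊞ ((-p last (c ⊙ v)) ⊙ f)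
      ≡⟨ cong₂ (λ i l → (0p ∷ i) ⊞ ((-p l) ⊙ f)) (proj₁ (init-last-⊙ c v)) (proj₂ (init-last-⊙ c v)) ⟩
    (0p ∷ (c ⊙ init v)) ⊞ ((-p (c *p last v)) ⊙ f)
      ≡⟨ cong₂ _⊞_ (cong (_∷ (c ⊙ init v)) (sym (*p-zeroʳ c)))
           (trans (cong (_⊙ f) (-p-*p c (last v))) (⊙-assoc c (-p last v) f)) ⟩
    (c ⊙ (0p ∷ init v)) ⊞ (c ⊙ ((-p last v) ⊙ f))
      ≡⟨ ⊙-distribˡ c (0p ∷ init v) ((-p last v) ⊙ f) ⟨
    c ⊙ mulX f v ∎

  -- `t *F u` is `horner t u` by definition. The left factor gets its own length so that induction
  -- can shorten it while the modulus keeps degree `m`.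
  horner : ∀ {k} → Vec (Fin p) k → 𝔽 → 𝔽
  horner v u = Vec.foldr (λ _ → 𝔽) (λ c acc → mulX fl acc +F scal c u) 0F v

  module MulX = Additive (mulX fl) (mulX-⊞ fl)

  horner-⊞ : ∀ {k} (t : Vec (Fin p) k) u v → horner t (u ⊞ v) ≡ horner t u ⊞ horner t v
  horner-⊞ []      u v = sym (+-identityˡ 𝟎)
  horner-⊞ (c ∷ t) u v = begin
    mulX fl (horner t (u ⊞ v)) ⊞ (c ⊙ (u ⊞ v))
      ≡⟨ cong₂ _⊞_ (trans (cong (mulX fl) (horner-⊞ t u v)) (mulX-⊞ fl _ _)) (⊙-distribˡ c u v) ⟩
    (mulX fl (horner t u) ⊞ mulX fl (horner t v)) ⊞ ((c ⊙ u) ⊞ (c ⊙ v))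
      ≡⟨ interchange (mulX fl (horner t u)) (mulX fl (horner t v)) (c ⊙ u) (c ⊙ v) ⟩
    horner (c ∷ t) u ⊞ horner (c ∷ t) v ∎

  horner-⊙ : ∀ {k} (t : Vec (Fin p) k) d u → horner t (d ⊙ u) ≡ d ⊙ horner t u
  horner-⊙ []      d u = sym (⊙-zeroʳ d)
  horner-⊙ (c ∷ t) d u = begin
    mulX fl (horner t (d ⊙ u)) ⊞ (c ⊙ (d ⊙ u))
      ≡⟨ cong₂ _⊞_ (trans (cong (mulX fl) (horner-⊙ t d u)) (mulX-⊙ fl d _)) (⊙-comm c d u) ⟩
    (d ⊙ mulX fl (horner t u)) ⊞ (d ⊙ (c ⊙ u))
      ≡⟨ ⊙-distribˡ d _ _ ⟨
    d ⊙ horner (c ∷ t) u ∎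

  horner-mulX : ∀ {k} (t : Vec (Fin p) k) u → horner t (mulX fl u) ≡ mulX fl (horner t u)
  horner-mulX []      u = sym MulX.φ-𝟎
  horner-mulX (c ∷ t) u = begin
    mulX fl (horner t (mulX fl u)) ⊞ (c ⊙ mulX fl u)
      ≡⟨ cong₂ _⊞_ (cong (mulX fl) (horner-mulX t u)) (sym (mulX-⊙ fl c u)) ⟩
    mulX fl (mulX fl (horner t u)) ⊞ mulX fl (c ⊙ u)
      ≡⟨ mulX-⊞ fl _ _ ⟨
    mulX fl (horner (c ∷ t) u) ∎

  -- Multiplication by `t` is additive, homogeneous and commutes with `mulX fl`, hence with every
  -- polynomial in `mulX fl`. At `u = 1F` this becomes commutativity.
  *F-horner : ∀ {k} t (v : Vec (Fin p) k) u → t *F horner v u ≡ horner v (t *F u)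
  *F-horner t []      u = Additive.φ-𝟎 (t *F_) (horner-⊞ t)
  *F-horner t (c ∷ v) u = begin
    t *F (mulX fl (horner v u) ⊞ (c ⊙ u))
      ≡⟨ horner-⊞ t _ _ ⟩
    (t *F mulX fl (horner v u)) ⊞ (t *F (c ⊙ u))
      ≡⟨ cong₂ _⊞_ (trans (horner-mulX t _) (cong (mulX fl) (*F-horner t v u))) (horner-⊙ t c u) ⟩
    horner (c ∷ v) (t *F u) ∎

  horner-𝟎 : ∀ k u → horner (𝟎 {k}) u ≡ 𝟎
  horner-𝟎 zero    u = refl
  horner-𝟎 (suc k) u = trans (cong₂ _⊞_ (trans (cong (mulX fl) (horner-𝟎 k u)) MulX.φ-𝟎) (⊙-zeroˡ u)) (+-identityˡ 𝟎)

  -- The relation "`w` is `v` followed by zeros", given as a family to avoid casts between lengths.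
  data Padding : ∀ {j k} → Vec (Fin p) j → Vec (Fin p) k → Set where
    pad  : ∀ {k} → Padding [] (𝟎 {k})
    cons : ∀ {j k} c {v : Vec (Fin p) j} {w : Vec (Fin p) k} → Padding v w → Padding (c ∷ v) (c ∷ w)

  Padding-≡ : ∀ {k} {v w : Vec (Fin p) k} → Padding v w → v ≡ w
  Padding-≡ pad        = refl
  Padding-≡ (cons c q) = cong (c ∷_) (Padding-≡ q)

  Padding-init-last : ∀ {j k} {v : Vec (Fin p) j} {w : Vec (Fin p) (suc k)} → j ℕ.≤ k →
    Padding v w → Padding v (init w) × last w ≡ 0p
  Padding-init-last {k = zero}  _ pad = pad , refl
  Padding-init-last {k = suc k} _ pad with Padding-init-last {k = k} z≤n pad
  ... | i , l = cons-pad i , l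
    where
    cons-pad : ∀ {k} {w : Vec (Fin p) k} → Padding [] w → Padding [] (0p ∷ w)
    cons-pad pad = pad
  Padding-init-last {k = suc k} (s≤s j≤k) (cons c {w = _ ∷ _} q) with Padding-init-last j≤k q
  ... | i , l = cons c i , l

module _ (p : ℕ) .{{_ : NonZero p}} where

  -- No reduction modulo f takes place: before each shift the intermediate result comes from a
  -- vector shorter than the modulus, so its top coefficient is 0 and `mulX` merely shifts.
  horner-1F : ∀ m (fl : Vec (Fin p) m) {j} (v : Vec (Fin p) j) → j ℕ.≤ m →
    let open FieldLemmas p m fl in Padding v (horner v (Field.1F p m fl))
  horner-1F m fl []      _ = FieldLemmas.pad
  horner-1F (suc m) fl (c ∷ v) (s≤s j≤m) = subst (Padding (c ∷ v)) (sym eq) (cons c (proj₁ w-split))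
    where
    open Field p (suc m) fl
    open FieldLemmas p (suc m) fl
    open ≡-Reasoning
    w : 𝔽
    w = horner v 1F
    w-split : Padding v (init w) × last w ≡ 0p
    w-split = Padding-init-last j≤m (horner-1F (suc m) fl v (ℕₚ.m≤n⇒m≤1+n j≤m))
    -p-zero : -p 0p ≡ 0p
    -p-zero = trans (sym (+p-identityˡ _)) (-p-inverseʳ 0p)
    eq : mulX fl w ⊞ (c ⊙ 1F) ≡ c ∷ init w
    eq = begin
      ((0p ∷ init w) ⊞ ((-p last w) ⊙ fl)) ⊞ (c ⊙ 1F)
        ≡⟨ cong (λ z → ((0p ∷ init w) ⊞ z) ⊞ (c ⊙ 1F)) (trans (cong (_⊙ fl) (trans (cong -p_ (proj₂ w-split)) -p-zero)) (⊙-zeroˡ fl)) ⟩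
      ((0p ∷ init w) ⊞ 𝟎) ⊞ (c ⊙ 1F)
        ≡⟨ cong₂ _⊞_ (+-identityʳ (0p ∷ init w)) (cong₂ _∷_ (trans (*p-comm c 1p) (*p-identityˡ c)) (⊙-zeroʳ c)) ⟩
      (0p ∷ init w) ⊞ (c ∷ 𝟎)
        ≡⟨ cong₂ _∷_ (+p-identityˡ c) (+-identityʳ (init w)) ⟩
      c ∷ init w ∎

module FieldMul (p : ℕ) .{{_ : NonZero p}} (m : ℕ) (fl : Vec (Fin p) m) where
  open Field p m fl
  open FieldLemmas p m fl public
  open ≡-Reasoning

  *F-identityʳ : ∀ t → t *F 1F ≡ t
  *F-identityʳ t = sym (Padding-≡ (horner-1F p m fl t ℕₚ.≤-refl))

  *F-comm : ∀ t u → t *F u ≡ u *F t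
  *F-comm t u = begin
    t *F u          ≡⟨ cong (t *F_) (*F-identityʳ u) ⟨
    t *F (u *F 1F)  ≡⟨ *F-horner t u 1F ⟩
    u *F (t *F 1F)  ≡⟨ cong (u *F_) (*F-identityʳ t) ⟩
    u *F t          ∎

  *F-negʳ : ∀ t u → t *F (-F u) ≡ -F (t *F u)
  *F-negʳ t = Additive.φ-neg (t *F_) (horner-⊞ t)

  *F-negˡ : ∀ t u → (-F t) *F u ≡ -F (t *F u)
  *F-negˡ t u = trans (*F-comm (-F t) u) (trans (*F-negʳ u t) (cong -F_ (*F-comm u t)))

  *F-scalˡ : ∀ c t u → scal c t *F u ≡ scal c (t *F u)
  *F-scalˡ c t u = trans (*F-comm (scal c t) u) (trans (horner-⊙ u c t) (cong (scal c) (*F-comm u t)))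

  [-t]^1 : ∀ t → (-F t) ^F 1 ≡ -F (t ^F 1)
  [-t]^1 t = *F-negˡ t 1F

  [-t]^2 : ∀ t → (-F t) ^F 2 ≡ t ^F 2
  [-t]^2 t = begin
    (-F t) *F ((-F t) ^F 1)   ≡⟨ cong ((-F t) *F_) ([-t]^1 t) ⟩
    (-F t) *F (-F (t ^F 1))   ≡⟨ *F-negˡ t _ ⟩
    -F (t *F (-F (t ^F 1)))   ≡⟨ cong -F_ (*F-negʳ t _) ⟩
    -F (-F (t ^F 2))          ≡⟨ ⁻¹-involutive (t ^F 2) ⟩
    t ^F 2                    ∎

  [-t]^3 : ∀ t → (-F t) ^F 3 ≡ -F (t ^F 3)
  [-t]^3 t = trans (cong ((-F t) *F_) ([-t]^2 t)) (*F-negˡ t _)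

  [c⊙t]^ : ∀ c t i → scal [ c ] t ^F i ≡ scal [ c ℕ.^ i ] (t ^F i)
  [c⊙t]^ c t zero    = sym (⊙-identity 1F)
  [c⊙t]^ c t (suc i) = begin
    scal [ c ] t *F (scal [ c ] t ^F i)              ≡⟨ cong (scal [ c ] t *F_) ([c⊙t]^ c t i) ⟩
    scal [ c ] t *F scal [ c ℕ.^ i ] (t ^F i)        ≡⟨ *F-scalˡ [ c ] t _ ⟩
    scal [ c ] (t *F scal [ c ℕ.^ i ] (t ^F i))      ≡⟨ cong (scal [ c ]) (horner-⊙ t [ c ℕ.^ i ] _) ⟩
    scal [ c ] (scal [ c ℕ.^ i ] (t ^F suc i))       ≡⟨ ⊙-assoc [ c ] [ c ℕ.^ i ] _ ⟨
    scal ([ c ] *p [ c ℕ.^ i ]) (t ^F suc i)         ≡⟨ cong (λ z → scal z (t ^F suc i)) (*p-[] c (c ℕ.^ i)) ⟩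
    scal [ c ℕ.^ suc i ] (t ^F suc i)                ∎

constF-* : ∀ (p : ℕ) .{{_ : NonZero p}} m (fl : Vec (Fin p) m) c u →
  let open Field p m fl in constF c *F u ≡ scal c u
constF-* p zero    fl c [] = refl
constF-* p (suc m) fl c u  = trans (cong (_⊞ (c ⊙ u)) (trans (cong (mulX fl) (horner-𝟎 m u)) MulX.φ-𝟎)) (+-identityˡ (c ⊙ u))
  where
  open Field p (suc m) fl
  open FieldLemmas p (suc m) fl

Deg≤1-1F : ∀ (p : ℕ) .{{_ : NonZero p}} m (fl : Vec (Fin p) m) → Field.Deg≤1 p m fl (Field.1F p m fl)
Deg≤1-1F p (suc m) fl (Fin.suc i) _ = lookup-replicate i (Field.0p p m (replicate m (0 mod p)))

-- Degree at least 2 makes x its own representative; in degree 1 it would reduce to a constant.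
*-X : ∀ (p : ℕ) .{{_ : NonZero p}} m (fl : Vec (Fin p) (2 ℕ.+ m)) →
  let open Field p (2 ℕ.+ m) fl in
  ∃ λ X → Deg≤1 X × (∀ u → X *F u ≡ mulX fl u)
*-X p m fl = (0p ∷ 1p ∷ 𝟎) , deg , mul
  where
  open Field p (2 ℕ.+ m) fl
  open FieldLemmas p (2 ℕ.+ m) fl
  open ≡-Reasoning
  deg : Deg≤1 (0p ∷ 1p ∷ 𝟎)
  deg (Fin.suc (Fin.suc i)) _ = lookup-replicate i 0p
  deg Fin.zero ()
  deg (Fin.suc Fin.zero) (s≤s ())
  mul : ∀ u → (0p ∷ 1p ∷ 𝟎) *F u ≡ mulX fl u
  mul u = begin
    mulX fl (mulX fl (horner (𝟎 {m}) u) ⊞ (1p ⊙ u)) ⊞ (0p ⊙ u)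
      ≡⟨ cong₂ (λ y z → mulX fl (mulX fl y ⊞ z) ⊞ (0p ⊙ u)) (horner-𝟎 m u) (⊙-identity u) ⟩
    mulX fl (mulX fl 𝟎 ⊞ u) ⊞ (0p ⊙ u)
      ≡⟨ cong₂ (λ y z → mulX fl (y ⊞ u) ⊞ z) MulX.φ-𝟎 (⊙-zeroˡ u) ⟩
    mulX fl (𝟎 ⊞ u) ⊞ 𝟎
      ≡⟨ +-identityʳ _ ⟩
    mulX fl (𝟎 ⊞ u)
      ≡⟨ cong (mulX fl) (+-identityˡ u) ⟩
    mulX fl u ∎

-- Integral bilinear forms and root systems

sumℤ-cong : ∀ {k} {f g : Fin k → ℤ} → (∀ i → f i ≡ g i) → sumℤ f ≡ sumℤ g
sumℤ-cong {zero}  eq = refl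
sumℤ-cong {suc k} eq = cong₂ ℤ._+_ (eq Fin.zero) (sumℤ-cong (eq ∘ Fin.suc))

sumℤ-+ : ∀ {k} (f g : Fin k → ℤ) → sumℤ (λ i → f i ℤ.+ g i) ≡ sumℤ f ℤ.+ sumℤ g
sumℤ-+ {zero}  f g = refl
sumℤ-+ {suc k} f g = trans (cong (λ z → (f Fin.zero ℤ.+ g Fin.zero) ℤ.+ z) (sumℤ-+ (f ∘ Fin.suc) (g ∘ Fin.suc)))
  (swap (f Fin.zero) (g Fin.zero) _ _)
  where
  swap : ∀ a b c d → (a ℤ.+ b) ℤ.+ (c ℤ.+ d) ≡ (a ℤ.+ c) ℤ.+ (b ℤ.+ d)
  swap = solve-∀

sumℤ-* : ∀ {k} c (f : Fin k → ℤ) → sumℤ (λ i → c ℤ.* f i) ≡ c ℤ.* sumℤ f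
sumℤ-* {zero}  c f = sym (ℤₚ.*-zeroʳ c)
sumℤ-* {suc k} c f = trans (cong (λ z → c ℤ.* f Fin.zero ℤ.+ z) (sumℤ-* c (f ∘ Fin.suc)))
  (sym (ℤₚ.*-distribˡ-+ c (f Fin.zero) _))

sumℤ-0 : ∀ k → sumℤ {k} (λ _ → 0ℤ) ≡ 0ℤ
sumℤ-0 zero    = refl
sumℤ-0 (suc k) = trans (ℤₚ.+-identityˡ _) (sumℤ-0 k)

sumℤ-swap : ∀ {j k} (f : Fin j → Fin k → ℤ) →
            sumℤ (λ a → sumℤ (f a)) ≡ sumℤ (λ b → sumℤ (λ a → f a b))
sumℤ-swap {zero}  {k} f = sym (sumℤ-0 k)
sumℤ-swap {suc j} f = trans (cong (λ z → sumℤ (f Fin.zero) ℤ.+ z) (sumℤ-swap (f ∘ Fin.suc)))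
  (sym (sumℤ-+ (f Fin.zero) (λ b → sumℤ (λ a → f (Fin.suc a) b))))

module _ {n} (G : Fin n → Fin n → ℤ) where

  private
    term : ZVec n → ZVec n → Fin n → Fin n → ℤ
    term u w i j = lookup u i ℤ.* (G i j ℤ.* lookup w j)

  bil-+ˡ : ∀ u v w → bil G (u +v v) w ≡ bil G u w ℤ.+ bil G v w
  bil-+ˡ u v w = trans (sumℤ-cong λ i → trans (sumℤ-cong λ j →
      trans (cong (ℤ._* (G i j ℤ.* lookup w j)) (lookup-zipWith ℤ._+_ i u v))
            (ℤₚ.*-distribʳ-+ (G i j ℤ.* lookup w j) (lookup u i) (lookup v i)))
      (sumℤ-+ (term u w i) (term v w i)))
    (sumℤ-+ (λ i → sumℤ (term u w i)) (λ i → sumℤ (term v w i)))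

  bil-·ˡ : ∀ k u w → bil G (k ·v u) w ≡ k ℤ.* bil G u w
  bil-·ˡ k u w = trans (sumℤ-cong λ i → trans (sumℤ-cong λ j →
      trans (cong (ℤ._* (G i j ℤ.* lookup w j)) (lookup-map i (k ℤ.*_) u))
            (ℤₚ.*-assoc k (lookup u i) (G i j ℤ.* lookup w j)))
      (sumℤ-* k (term u w i)))
    (sumℤ-* k (λ i → sumℤ (term u w i)))

  bil-sym : (∀ i j → G i j ≡ G j i) → ∀ u v → bil G u v ≡ bil G v u
  bil-sym G-sym u v = trans (sumℤ-swap (term u v))
    (sumℤ-cong λ j → sumℤ-cong λ i →
      trans (cong (λ g → lookup u i ℤ.* (g ℤ.* lookup v j)) (G-sym i j)) (rotate (lookup u i) (G j i) (lookup v j)))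
    where
    rotate : ∀ a g b → a ℤ.* (g ℤ.* b) ≡ b ℤ.* (g ℤ.* a)
    rotate = solve-∀

lin : ∀ {n} → ℤ → ℤ → ZVec n → ZVec n → ZVec n
lin i j u v = (i ·v u) +v (j ·v v)

lin-lin : ∀ {n} k l i j i′ j′ (u v : ZVec n) →
  lin k l (lin i j u v) (lin i′ j′ u v) ≡ lin (k ℤ.* i ℤ.+ l ℤ.* i′) (k ℤ.* j ℤ.+ l ℤ.* j′) u v
lin-lin k l i j i′ j′ []      []      = refl
lin-lin k l i j i′ j′ (a ∷ u) (b ∷ v) = cong₂ _∷_ (eq k l i j i′ j′ a b) (lin-lin k l i j i′ j′ u v)
  where
  eq : ∀ k l i j i′ j′ a b → k ℤ.* (i ℤ.* a ℤ.+ j ℤ.* b) ℤ.+ l ℤ.* (i′ ℤ.* a ℤ.+ j′ ℤ.* b)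
     ≡ (k ℤ.* i ℤ.+ l ℤ.* i′) ℤ.* a ℤ.+ (k ℤ.* j ℤ.+ l ℤ.* j′) ℤ.* b
  eq = solve-∀

lin-10 : ∀ {n} (u v : ZVec n) → lin 1ℤ 0ℤ u v ≡ u
lin-10 []      []      = refl
lin-10 (a ∷ u) (b ∷ v) = cong₂ _∷_ (eq a b) (lin-10 u v)
  where
  eq : ∀ a b → 1ℤ ℤ.* a ℤ.+ 0ℤ ℤ.* b ≡ a
  eq = solve-∀

lin-swap : ∀ {n} i j (u v : ZVec n) → lin i j u v ≡ lin j i v u
lin-swap i j []      []      = refl
lin-swap i j (a ∷ u) (b ∷ v) = cong₂ _∷_ (ℤₚ.+-comm (i ℤ.* a) (j ℤ.* b)) (lin-swap i j u v)

lin-01 : ∀ {n} (u v : ZVec n) → lin 0ℤ 1ℤ u v ≡ v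
lin-01 u v = trans (lin-swap 0ℤ 1ℤ u v) (lin-10 v u)

+v≡lin : ∀ {n} (u v : ZVec n) → u +v v ≡ lin 1ℤ 1ℤ u v
+v≡lin []      []      = refl
+v≡lin (a ∷ u) (b ∷ v) = cong₂ _∷_ (cong₂ ℤ._+_ (sym (ℤₚ.*-identityˡ a)) (sym (ℤₚ.*-identityˡ b))) (+v≡lin u v)

sub≡lin : ∀ {n} k (u v : ZVec n) → u +v (-v (k ·v v)) ≡ lin 1ℤ (ℤ.- k) u v
sub≡lin k []      []      = refl
sub≡lin k (a ∷ u) (b ∷ v) = cong₂ _∷_ (cong₂ ℤ._+_ (sym (ℤₚ.*-identityˡ a)) (ℤₚ.neg-distribˡ-* k b)) (sub≡lin k u v)

-v≡lin : ∀ {n} (u v : ZVec n) → -v u ≡ lin -1ℤ 0ℤ u v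
-v≡lin []      []      = refl
-v≡lin (a ∷ u) (b ∷ v) = cong₂ _∷_ (eq a b) (-v≡lin u v)
  where
  eq : ∀ a b → ℤ.- a ≡ -1ℤ ℤ.* a ℤ.+ 0ℤ ℤ.* b
  eq = solve-∀

·v≡lin : ∀ {n} k (u v : ZVec n) → k ·v u ≡ lin k 0ℤ u v
·v≡lin k []      []      = refl
·v≡lin k (a ∷ u) (b ∷ v) = cong₂ _∷_ (eq k a b) (·v≡lin k u v)
  where
  eq : ∀ k a b → k ℤ.* a ≡ k ℤ.* a ℤ.+ 0ℤ ℤ.* b
  eq = solve-∀

lin-00 : ∀ {n} (u v : ZVec n) → lin 0ℤ 0ℤ u v ≡ 0v
lin-00 []      []      = refl
lin-00 (a ∷ u) (b ∷ v) = cong (0ℤ ∷_) (lin-00 u v)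

lin-0⇒·v : ∀ {n} k l (u v : ZVec n) → lin k (ℤ.- l) u v ≡ 0v → k ·v u ≡ l ·v v
lin-0⇒·v k l []      []      eq = refl
lin-0⇒·v k l (a ∷ u) (b ∷ v) eq = cong₂ _∷_
  (ℤₚ.i-j≡0⇒i≡j _ _ (trans (cong (λ z → k ℤ.* a ℤ.+ z) (ℤₚ.neg-distribˡ-* l b)) (cong Vec.head eq)))
  (lin-0⇒·v k l u v (cong Vec.tail eq))

∣z∣≤3 : ∀ {z} → 0ℤ ℤ.≤ z → z ℤ.< + 4 → ℤ.∣ z ∣ ℕ.≤ 3
∣z∣≤3 (+≤+ _) (+<+ (s≤s z≤3)) = z≤3

-- Cartan integers and their bound

module Roots {n} (R : RootSystem n) where
  open RS R

  bil-lin : ∀ i j u v w → bil G (lin i j u v) w ≡ i ℤ.* bil G u w ℤ.+ j ℤ.* bil G v w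
  bil-lin i j u v w = trans (bil-+ˡ G (i ·v u) (j ·v v) w) (cong₂ ℤ._+_ (bil-·ˡ G i u w) (bil-·ˡ G j v w))

  opaque
    B : Fin N → Fin N → ℤ
    B a b = bil G (root a) (root b)

    B≡bil : ∀ a b → B a b ≡ bil G (root a) (root b)
    B≡bil a b = refl

  B-sym : ∀ a b → B a b ≡ B b a
  B-sym a b = trans (B≡bil a b) (trans (bil-sym G G-sym (root a) (root b)) (sym (B≡bil b a)))

  bil-lin-root : ∀ i j a b d → bil G (lin i j (root a) (root b)) (root d) ≡ i ℤ.* B a d ℤ.+ j ℤ.* B b d
  bil-lin-root i j a b d = trans (bil-lin i j (root a) (root b) (root d))
    (sym (cong₂ (λ y z → i ℤ.* y ℤ.+ j ℤ.* z) (B≡bil a d) (B≡bil b d)))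

  B-lin : ∀ i j {a b c} → root c ≡ lin i j (root a) (root b) → ∀ d → B c d ≡ i ℤ.* B a d ℤ.+ j ℤ.* B b d
  B-lin i j {a} {b} {c} eq d = trans (B≡bil c d) (trans (cong (λ v → bil G v (root d)) eq) (bil-lin-root i j a b d))

  ≡⇒B : ∀ {a b} → root b ≡ root a → ∀ d → B b d ≡ B a d
  ≡⇒B {a} {b} eq d = trans (B≡bil b d) (trans (cong (λ v → bil G v (root d)) eq) (sym (B≡bil a d)))

  Q>0 : ∀ a → 0ℤ ℤ.< B a a
  Q>0 a = subst (0ℤ ℤ.<_) (sym (B≡bil a a)) (G-posdef (root a) (nonzero a))

  cartan-def-B : ∀ b a → cartan b a ℤ.* B a a ≡ + 2 ℤ.* B b a
  cartan-def-B b a = trans (cong (cartan b a ℤ.*_) (B≡bil a a)) (trans (cartan-def b a) (cong (+ 2 ℤ.*_) (sym (B≡bil b a))))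

  Q-pos : ∀ a → ℤ.Positive (B a a)
  Q-pos a = ℤ.positive (Q>0 a)

  Q-nonZero : ∀ a → ℤ.NonZero (B a a)
  Q-nonZero a = ℤ.≢-nonZero (λ eq → ℤₚ.<-irrefl (sym eq) (Q>0 a))

  cartan-unique : ∀ c d k → + 2 ℤ.* B c d ≡ k ℤ.* B d d → cartan c d ≡ k
  cartan-unique c d k eq = ℤₚ.*-cancelʳ-≡ _ _ (B d d) {{Q-nonZero d}} (trans (cartan-def-B c d) eq)

  neg : Fin N → Fin N
  neg a = proj₁ (reflect a a)

  root-neg : ∀ a → root (neg a) ≡ lin -1ℤ 0ℤ (root a) (root a)
  root-neg a = begin
    root (neg a)                                  ≡⟨ proj₂ (reflect a a) ⟩
    root a +v (-v (cartan a a ·v root a))         ≡⟨ cong (λ k → root a +v (-v (k ·v root a))) (cartan-unique a a (+ 2) refl) ⟩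
    root a +v (-v ((+ 2) ·v root a))                ≡⟨ sub≡lin (+ 2) (root a) (root a) ⟩
    lin 1ℤ (ℤ.- + 2) (root a) (root a)            ≡⟨ lin-diag (root a) ⟩
    lin -1ℤ 0ℤ (root a) (root a)                  ∎
    where
    open ≡-Reasoning
    eq : ∀ a → 1ℤ ℤ.* a ℤ.+ (ℤ.- + 2) ℤ.* a ≡ -1ℤ ℤ.* a ℤ.+ 0ℤ ℤ.* a
    eq = solve-∀
    lin-diag : ∀ {n} (u : ZVec n) → lin 1ℤ (ℤ.- + 2) u u ≡ lin -1ℤ 0ℤ u u
    lin-diag []      = refl
    lin-diag (a ∷ u) = cong₂ _∷_ (eq a) (lin-diag u)

  record Independent (a b : Fin N) : Set where
    constructor independent
    field
      ≢+ : root b ≢ root a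
      ≢- : root b ≢ -v root a
  open Independent

  ≡-v⇒B : ∀ {a b} → root b ≡ -v root a → ∀ d → B b d ≡ ℤ.- B a d
  ≡-v⇒B {a} {b} eq d = trans (B-lin -1ℤ 0ℤ {a} {a} (trans eq (-v≡lin (root a) (root a))) d) (simp (B a d))
    where
    simp : ∀ z → -1ℤ ℤ.* z ℤ.+ 0ℤ ℤ.* z ≡ ℤ.- z
    simp = solve-∀

  cauchy-schwarz : ∀ {a b} → Independent a b → B a b ℤ.* B a b ℤ.< B a a ℤ.* B b b
  cauchy-schwarz {a} {b} ind = ℤₚ.*-cancelˡ-<-nonNeg (B a a) {{ℤ.nonNegative (ℤₚ.<⇒≤ (Q>0 a))}} Qlt
    where
    open ≡-Reasoning
    q = B a a
    r = B a b
    s = B b b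
    -- `v` is `q` times the component of b orthogonal to a, so (v, v) = q(qs - r²). It is nonzero
    -- because `reduced` allows only ±a as multiples of a.
    v : ZVec n
    v = lin q (ℤ.- r) (root b) (root a)
    v≢0 : v ≢ 0v
    v≢0 eq = [ ≢+ ind , ≢- ind ]′ (reduced a b r q (λ eq → ℤₚ.<-irrefl (sym eq) (Q>0 a)) (lin-0⇒·v q r (root b) (root a) eq))
    expand : ∀ q r s → q ℤ.* (q ℤ.* s ℤ.+ (ℤ.- r) ℤ.* r) ℤ.+ (ℤ.- r) ℤ.* (q ℤ.* r ℤ.+ (ℤ.- r) ℤ.* q)
           ≡ q ℤ.* (q ℤ.* s) ℤ.- q ℤ.* (r ℤ.* r)
    expand = solve-∀
    bv : ∀ d → bil G v (root d) ≡ q ℤ.* B b d ℤ.+ (ℤ.- r) ℤ.* B a d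
    bv d = bil-lin-root q (ℤ.- r) b a d
    vv : bil G v v ≡ q ℤ.* (q ℤ.* s) ℤ.- q ℤ.* (r ℤ.* r)
    vv = begin
      bil G v v
        ≡⟨ bil-lin q (ℤ.- r) (root b) (root a) v ⟩
      q ℤ.* bil G (root b) v ℤ.+ (ℤ.- r) ℤ.* bil G (root a) v
        ≡⟨ cong₂ (λ y z → q ℤ.* y ℤ.+ (ℤ.- r) ℤ.* z)
             (trans (bil-sym G G-sym (root b) v) (bv b))
             (trans (bil-sym G G-sym (root a) v) (trans (bv a) (cong (λ z → q ℤ.* z ℤ.+ (ℤ.- r) ℤ.* q) (B-sym b a)))) ⟩
      q ℤ.* (q ℤ.* s ℤ.+ (ℤ.- r) ℤ.* r) ℤ.+ (ℤ.- r) ℤ.* (q ℤ.* r ℤ.+ (ℤ.- r) ℤ.* q)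
        ≡⟨ expand q r s ⟩
      q ℤ.* (q ℤ.* s) ℤ.- q ℤ.* (r ℤ.* r) ∎
    Qlt : q ℤ.* (r ℤ.* r) ℤ.< q ℤ.* (q ℤ.* s)
    Qlt with ℤₚ.<-cmp (q ℤ.* (r ℤ.* r)) (q ℤ.* (q ℤ.* s))
    ... | tri< lt _ _ = lt
    ... | tri≈ _ eq _ = ⊥-elim (ℤₚ.<-irrefl (sym (trans vv (trans (cong (λ z → q ℤ.* (q ℤ.* s) ℤ.- z) eq) (ℤₚ.+-inverseʳ (q ℤ.* (q ℤ.* s)))))) (G-posdef v v≢0))
    ... | tri> _ _ gt = ⊥-elim (ℤₚ.<-irrefl refl (ℤₚ.<-≤-trans (subst (0ℤ ℤ.<_) vv (G-posdef v v≢0)) (ℤₚ.i≤j⇒i-j≤0 (ℤₚ.<⇒≤ gt))))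

  -- The product of the two Cartan integers is 4cos²θ; this is that identity cleared of
  -- denominators.
  cartan-product : ∀ a b → (cartan b a ℤ.* cartan a b) ℤ.* (B a a ℤ.* B b b) ≡ + 4 ℤ.* (B a b ℤ.* B a b)
  cartan-product a b = begin
    (cartan b a ℤ.* cartan a b) ℤ.* (B a a ℤ.* B b b)    ≡⟨ shuffle (cartan b a) (cartan a b) (B a a) (B b b) ⟩
    (cartan b a ℤ.* B a a) ℤ.* (cartan a b ℤ.* B b b)    ≡⟨ cong₂ ℤ._*_ (cartan-def-B b a) (cartan-def-B a b) ⟩
    (+ 2 ℤ.* B b a) ℤ.* (+ 2 ℤ.* B a b)                  ≡⟨ cong (λ z → (+ 2 ℤ.* z) ℤ.* (+ 2 ℤ.* B a b)) (B-sym b a) ⟩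
    (+ 2 ℤ.* B a b) ℤ.* (+ 2 ℤ.* B a b)                  ≡⟨ four (B a b) ⟩
    + 4 ℤ.* (B a b ℤ.* B a b)                            ∎
    where
    open ≡-Reasoning
    shuffle : ∀ x y q s → (x ℤ.* y) ℤ.* (q ℤ.* s) ≡ (x ℤ.* q) ℤ.* (y ℤ.* s)
    shuffle = solve-∀
    four : ∀ r → (+ 2 ℤ.* r) ℤ.* (+ 2 ℤ.* r) ≡ + 4 ℤ.* (r ℤ.* r)
    four = solve-∀

  QQ-pos : ∀ a b → 0ℤ ℤ.< B a a ℤ.* B b b
  QQ-pos a b = subst (ℤ._< B a a ℤ.* B b b) (ℤₚ.*-zeroʳ (B a a)) (ℤₚ.*-monoˡ-<-pos (B a a) {{Q-pos a}} (Q>0 b))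

  cartan-product<4 : ∀ {a b} → Independent a b → cartan b a ℤ.* cartan a b ℤ.< + 4
  cartan-product<4 {a} {b} ind = ℤₚ.*-cancelʳ-<-nonNeg (B a a ℤ.* B b b) {{ℤ.nonNegative (ℤₚ.<⇒≤ (QQ-pos a b))}}
    (subst (ℤ._< + 4 ℤ.* (B a a ℤ.* B b b)) (sym (cartan-product a b)) (ℤₚ.*-monoˡ-<-pos (+ 4) (cauchy-schwarz ind)))

  square≥0 : ∀ r → 0ℤ ℤ.≤ r ℤ.* r
  square≥0 (+ zero)  = +≤+ z≤n
  square≥0 (+ suc r) = +≤+ z≤n
  square≥0 -[1+ r ]  = +≤+ z≤n

  cartan-product≥0 : ∀ a b → 0ℤ ℤ.≤ cartan b a ℤ.* cartan a b
  cartan-product≥0 a b = ℤₚ.*-cancelʳ-≤-pos _ _ (B a a ℤ.* B b b) {{ℤ.positive (QQ-pos a b)}}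
    (subst (ℤ._≤ (cartan b a ℤ.* cartan a b) ℤ.* (B a a ℤ.* B b b)) (sym (ℤₚ.*-zeroˡ (B a a ℤ.* B b b)))
      (subst (0ℤ ℤ.≤_) (sym (cartan-product a b)) (ℤₚ.*-monoˡ-≤-nonNeg (+ 4) (square≥0 (B a b)))))

  cartan-sym : ∀ a b → cartan b a ℤ.* B a a ≡ cartan a b ℤ.* B b b
  cartan-sym a b = trans (cartan-def-B b a) (trans (cong (+ 2 ℤ.*_) (B-sym b a)) (sym (cartan-def-B a b)))

  cartan-0 : ∀ a b → cartan a b ≡ 0ℤ → cartan b a ≡ 0ℤ
  cartan-0 a b eq = ℤₚ.*-cancelʳ-≡ _ _ (B a a) {{Q-nonZero a}} (trans (cartan-sym a b) (cong (ℤ._* B b b) eq))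

  -- For dependent roots the value is ±2. Otherwise the product of the two Cartan integers lies
  -- between 0 and 3, so it bounds either factor if the other is nonzero. Allowing all pairs lets
  -- the bound serve as a test of whether a vector can be a root.
  cartan-bound : ∀ b a → ℤ.∣ cartan b a ∣ ℕ.≤ 3
  cartan-bound b a with root b ≟v root a | root b ≟v (-v root a)
  ... | yes eq | _      = subst (λ z → ℤ.∣ z ∣ ℕ.≤ 3) (sym (cartan-unique b a (+ 2) (cong (+ 2 ℤ.*_) (≡⇒B {a} {b} eq a)))) (s≤s (s≤s z≤n))
  ... | no _   | yes eq = subst (λ z → ℤ.∣ z ∣ ℕ.≤ 3) (sym (cartan-unique b a (ℤ.- + 2) (trans (cong (+ 2 ℤ.*_) (≡-v⇒B {a} {b} eq a)) (move (B a a))))) (s≤s (s≤s z≤n))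
    where
    move : ∀ z → + 2 ℤ.* (ℤ.- z) ≡ (ℤ.- + 2) ℤ.* z
    move = solve-∀
  ... | no ≢+  | no ≢-  with cartan a b ℤ.≟ 0ℤ
  ...   | yes y≡0 = subst (λ z → ℤ.∣ z ∣ ℕ.≤ 3) (sym (cartan-0 a b y≡0)) z≤n
  ...   | no y≢0  = ℕₚ.≤-trans (ℕₚ.m≤m*n ℤ.∣ cartan b a ∣ ℤ.∣ cartan a b ∣ {{ℤ.≢-nonZero y≢0}})
                      (subst (ℕ._≤ 3) (ℤₚ.abs-* (cartan b a) (cartan a b))
                        (∣z∣≤3 (cartan-product≥0 a b) (cartan-product<4 (independent ≢+ ≢-))))

  0<B⇒0<cartan : ∀ a b → 0ℤ ℤ.< B a b → 0ℤ ℤ.< cartan a b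
  0<B⇒0<cartan a b 0<B = ℤₚ.*-cancelʳ-<-nonNeg (B b b) {{ℤ.nonNegative (ℤₚ.<⇒≤ (Q>0 b))}}
    (subst (0ℤ ℤ.* B b b ℤ.<_) (sym (cartan-def-B a b)) (subst (ℤ._< + 2 ℤ.* B a b) (sym (ℤₚ.*-zeroˡ (B b b))) (ℤₚ.*-monoˡ-<-pos (+ 2) 0<B)))

  0≤B⇒0≤cartan : ∀ a b → 0ℤ ℤ.≤ B a b → 0ℤ ℤ.≤ cartan a b
  0≤B⇒0≤cartan a b 0≤B = ℤₚ.*-cancelʳ-≤-pos _ _ (B b b) {{Q-pos b}}
    (subst (0ℤ ℤ.* B b b ℤ.≤_) (sym (cartan-def-B a b)) (subst (ℤ._≤ + 2 ℤ.* B a b) (sym (ℤₚ.*-zeroˡ (B b b))) (ℤₚ.*-monoˡ-≤-nonNeg (+ 2) 0≤B)))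

  one-is-1 : ∀ {x y} → 0ℤ ℤ.< x → 0ℤ ℤ.< y → x ℤ.* y ℤ.< + 4 → x ≡ 1ℤ ⊎ y ≡ 1ℤ
  one-is-1 {+ 1}           {y}             _ _ _ = inj₁ refl
  one-is-1 {+ suc (suc i)} {+ 1}           _ _ _ = inj₂ refl
  one-is-1 {+ suc (suc i)} {+ suc (suc j)} _ _ (+<+ lt) = ⊥-elim (ℕₚ.<⇒≱ lt (ℕₚ.*-mono-≤ {2} {suc (suc i)} {2} {suc (suc j)} (s≤s (s≤s z≤n)) (s≤s (s≤s z≤n))))
  one-is-1 {+ 0} (+<+ ())
  one-is-1 {+ suc (suc i)} {+ 0} _ (+<+ ())

  opaque
    -- Both Cartan integers are positive with product below 4, so one of them is 1. The
    -- corresponding reflection subtracts one root exactly once from the other, and negation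
    -- corrects the order if necessary.
    difference : ∀ a b → 0ℤ ℤ.< B a b → root a ≢ root b → ∃ λ c → root c ≡ lin 1ℤ -1ℤ (root a) (root b)
    difference a b 0<B a≢b with one-is-1 (0<B⇒0<cartan b a (subst (0ℤ ℤ.<_) (B-sym a b) 0<B)) (0<B⇒0<cartan a b 0<B)
                                  (cartan-product<4 (independent (a≢b ∘ sym) b≢-a))
      where
      b≢-a : root b ≢ -v root a
      b≢-a eq = ℤₚ.<-asym 0<B (subst (ℤ._< 0ℤ) (sym (trans (B-sym a b) (≡-v⇒B {a} {b} eq a))) (ℤₚ.neg-mono-< (Q>0 a)))
    ... | inj₂ y≡1 = proj₁ (reflect b a) , trans (proj₂ (reflect b a))
                       (trans (cong (λ k → root a +v (-v (k ·v root b))) y≡1) (sub≡lin 1ℤ (root a) (root b)))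
    ... | inj₁ x≡1 = neg c , (begin
        root (neg c)                              ≡⟨ root-neg c ⟩
        lin -1ℤ 0ℤ (root c) (root c)              ≡⟨ cong (λ v → lin -1ℤ 0ℤ v v) root-c ⟩
        lin -1ℤ 0ℤ (lin 1ℤ -1ℤ (root b) (root a)) (lin 1ℤ -1ℤ (root b) (root a))
                                                  ≡⟨ lin-lin -1ℤ 0ℤ 1ℤ -1ℤ 1ℤ -1ℤ (root b) (root a) ⟩
        lin -1ℤ 1ℤ (root b) (root a)              ≡⟨ lin-swap -1ℤ 1ℤ (root b) (root a) ⟩
        lin 1ℤ -1ℤ (root a) (root b)              ∎)
      where
      open ≡-Reasoning
      c : Fin N
      c = proj₁ (reflect a b)
      root-c : root c ≡ lin 1ℤ -1ℤ (root b) (root a)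
      root-c = trans (proj₂ (reflect a b)) (trans (cong (λ k → root b +v (-v (k ·v root a))) x≡1) (sub≡lin 1ℤ (root b) (root a)))

-v-involutive : ∀ {n} (u : ZVec n) → -v (-v u) ≡ u
-v-involutive []      = refl
-v-involutive (a ∷ u) = cong₂ _∷_ (ℤₚ.neg-involutive a) (-v-involutive u)

+v-inverseʳ : ∀ {n} (u : ZVec n) → u +v (-v u) ≡ 0v
+v-inverseʳ []      = refl
+v-inverseʳ (a ∷ u) = cong₂ _∷_ (ℤₚ.+-inverseʳ a) (+v-inverseʳ u)

sumℕ : ∀ {k} → (Fin k → ℕ) → ℕ
sumℕ {zero}  c = 0
sumℕ {suc k} c = c Fin.zero ℕ.+ sumℕ (c ∘ Fin.suc)

+v-assoc : ∀ {n} (u v w : ZVec n) → (u +v v) +v w ≡ u +v (v +v w)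
+v-assoc []      []      []      = refl
+v-assoc (a ∷ u) (b ∷ v) (c ∷ w) = cong₂ _∷_ (ℤₚ.+-assoc a b c) (+v-assoc u v w)

+v-comm : ∀ {n} (u v : ZVec n) → u +v v ≡ v +v u
+v-comm []      []      = refl
+v-comm (a ∷ u) (b ∷ v) = cong₂ _∷_ (ℤₚ.+-comm a b) (+v-comm u v)

·v-suc : ∀ {n} k (u : ZVec n) → (+ suc k) ·v u ≡ u +v ((+ k) ·v u)
·v-suc k []      = refl
·v-suc k (a ∷ u) = cong₂ _∷_ (ℤₚ.suc-* (+ k) a) (·v-suc k u)

remove-one : ∀ {k n} (c : Fin k → ℕ) (f : Fin k → ZVec n) i → 0 ℕ.< c i →
  ∃ λ c′ → sumℕV c f ≡ f i +v sumℕV c′ f × sumℕ c ≡ suc (sumℕ c′)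
remove-one c f Fin.zero c>0 with c Fin.zero in eq
... | suc d = (λ { Fin.zero → d ; (Fin.suc j) → c (Fin.suc j) })
    , trans (cong (_+v rest) (·v-suc d (f Fin.zero))) (+v-assoc (f Fin.zero) _ rest)
    , refl
  where
  rest = sumV (λ i → (+ c (Fin.suc i)) ·v f (Fin.suc i))
remove-one c f (Fin.suc i) c>0 with remove-one (c ∘ Fin.suc) (f ∘ Fin.suc) i c>0
... | c′ , eq , eqn = (λ { Fin.zero → c Fin.zero ; (Fin.suc j) → c′ j })
    , trans (cong (hd +v_) eq) (trans (sym (+v-assoc hd fi tl)) (trans (cong (_+v tl) (+v-comm hd fi)) (+v-assoc fi hd tl)))
    , trans (cong (c Fin.zero ℕ.+_) eqn) (ℕₚ.+-suc (c Fin.zero) (sumℕ c′))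
  where
  hd = (+ c Fin.zero) ·v f Fin.zero
  fi = f (Fin.suc i)
  tl = sumℕV c′ (f ∘ Fin.suc)

positive-term : ∀ {k} (c : Fin k → ℕ) (h : Fin k → ℤ) → 0ℤ ℤ.< sumℤ (λ i → (+ c i) ℤ.* h i) →
  ∃ λ i → 0 ℕ.< c i × 0ℤ ℤ.< h i
positive-term {zero}  c h (+<+ ())
positive-term {suc k} c h 0<Σ with 0ℤ ℤ.<? h Fin.zero | c Fin.zero in eq
... | yes 0<h | suc d = Fin.zero , subst (0 ℕ.<_) (sym eq) (s≤s z≤n) , 0<h
... | yes 0<h | zero  with positive-term (c ∘ Fin.suc) (h ∘ Fin.suc) (subst (0ℤ ℤ.<_) (trans (cong (ℤ._+ sumℤ (λ i → (+ c (Fin.suc i)) ℤ.* h (Fin.suc i))) (ℤₚ.*-zeroˡ (h Fin.zero))) (ℤₚ.+-identityˡ _)) 0<Σ)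
...   | i , p , q = Fin.suc i , p , q
-- The head contributes at most 0, so the remaining sum is still positive.
positive-term {suc k} c h 0<Σ | no h≤0 | d with positive-term (c ∘ Fin.suc) (h ∘ Fin.suc)
    (ℤₚ.<-≤-trans 0<Σ (subst ((+ d) ℤ.* h Fin.zero ℤ.+ rest ℤ.≤_) (ℤₚ.+-identityˡ rest)
      (ℤₚ.+-monoˡ-≤ rest (subst ((+ d) ℤ.* h Fin.zero ℤ.≤_) (ℤₚ.*-zeroʳ (+ d)) (ℤₚ.*-monoˡ-≤-nonNeg (+ d) (ℤₚ.≮⇒≥ h≤0))))))
  where
  rest = sumℤ (λ i → (+ c (Fin.suc i)) ℤ.* h (Fin.suc i))
...   | i , p , q = Fin.suc i , p , q

-- Sums of roots and configurations of rank two

module RootGeometry {n} (R : RootSystem n) where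
  open RS R
  open Roots R public

  bil-0v : ∀ w → bil G 0v w ≡ 0ℤ
  bil-0v w = trans (cong (λ v → bil G v w) (sym (lin-00 w w))) (trans (bil-lin 0ℤ 0ℤ w w w) (zeros (bil G w w)))
    where
    zeros : ∀ z → 0ℤ ℤ.* z ℤ.+ 0ℤ ℤ.* z ≡ 0ℤ
    zeros = solve-∀

  bil-sumℕV : ∀ {k} (c : Fin k → ℕ) (f : Fin k → ZVec n) w →
    bil G (sumℕV c f) w ≡ sumℤ (λ i → (+ c i) ℤ.* bil G (f i) w)
  bil-sumℕV {zero}  c f w = bil-0v w
  bil-sumℕV {suc k} c f w = trans (bil-+ˡ G ((+ c Fin.zero) ·v f Fin.zero) (sumℕV (c ∘ Fin.suc) (f ∘ Fin.suc)) w)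
    (cong₂ ℤ._+_ (bil-·ˡ G (+ c Fin.zero) (f Fin.zero) w) (bil-sumℕV (c ∘ Fin.suc) (f ∘ Fin.suc) w))

  B-sum : ∀ {k} (s : Fin k → Fin N) c {a} → root a ≡ sumℕV c (λ i → root (s i)) →
    B a a ≡ sumℤ (λ i → (+ c i) ℤ.* B (s i) a)
  B-sum s c {a} eq = begin
    B a a                                                   ≡⟨ B≡bil a a ⟩
    bil G (root a) (root a)                                 ≡⟨ cong (λ v → bil G v (root a)) eq ⟩
    bil G (sumℕV c (λ i → root (s i))) (root a)             ≡⟨ bil-sumℕV c (λ i → root (s i)) (root a) ⟩
    sumℤ (λ i → (+ c i) ℤ.* bil G (root (s i)) (root a))    ≡⟨ sumℤ-cong (λ i → cong ((+ c i) ℤ.*_) (B≡bil (s i) a)) ⟨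
    sumℤ (λ i → (+ c i) ℤ.* B (s i) a)                      ∎
    where open ≡-Reasoning

  root-neg′ : ∀ a → root (neg a) ≡ -v root a
  root-neg′ a = trans (root-neg a) (sym (-v≡lin (root a) (root a)))

  B-neg : ∀ a b → B a (neg b) ≡ ℤ.- B a b
  B-neg a b = trans (B-sym a (neg b)) (trans (≡-v⇒B {b} {neg b} (root-neg′ b) a) (cong ℤ.-_ (B-sym b a)))

  sum-root : ∀ a b → B a b ℤ.< 0ℤ → root b ≢ -v root a → (root a +v root b) ∈Φ
  sum-root a b B<0 b≢-a with difference a (neg b) (subst (0ℤ ℤ.<_) (sym (B-neg a b)) (ℤₚ.neg-mono-< B<0))
                              (λ eq → b≢-a (trans (sym (-v-involutive (root b))) (cong -v_ (sym (trans eq (root-neg′ b))))))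
  ... | c , eq = c , trans eq (begin
      lin 1ℤ -1ℤ (root a) (root (neg b))   ≡⟨ sub≡lin 1ℤ (root a) (root (neg b)) ⟨
      root a +v (-v (1ℤ ·v root (neg b)))  ≡⟨ cong (λ v → root a +v (-v v)) (trans (·v≡lin 1ℤ (root (neg b)) (root a)) (lin-10 (root (neg b)) (root a))) ⟩
      root a +v (-v root (neg b))          ≡⟨ cong (λ v → root a +v (-v v)) (root-neg′ b) ⟩
      root a +v (-v (-v root b))           ≡⟨ cong (root a +v_) (-v-involutive (root b)) ⟩
      root a +v root b                     ∎)
    where open ≡-Reasoning

  cartan-lin : ∀ i j {a b c} → root c ≡ lin i j (root a) (root b) → cartan c a ≡ + 2 ℤ.* i ℤ.+ j ℤ.* cartan b a
  cartan-lin i j {a} {b} {c} eq = cartan-unique c a _ (begin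
      + 2 ℤ.* B c a                                        ≡⟨ cong (+ 2 ℤ.*_) (B-lin i j {a} {b} {c} eq a) ⟩
      + 2 ℤ.* (i ℤ.* B a a ℤ.+ j ℤ.* B b a)                ≡⟨ push i j (B a a) (B b a) ⟩
      + 2 ℤ.* i ℤ.* B a a ℤ.+ j ℤ.* (+ 2 ℤ.* B b a)        ≡⟨ cong (λ z → + 2 ℤ.* i ℤ.* B a a ℤ.+ j ℤ.* z) (cartan-def-B b a) ⟨
      + 2 ℤ.* i ℤ.* B a a ℤ.+ j ℤ.* (cartan b a ℤ.* B a a) ≡⟨ pull i j (cartan b a) (B a a) ⟩
      (+ 2 ℤ.* i ℤ.+ j ℤ.* cartan b a) ℤ.* B a a           ∎)
    where
    open ≡-Reasoning
    push : ∀ i j q r → + 2 ℤ.* (i ℤ.* q ℤ.+ j ℤ.* r) ≡ + 2 ℤ.* i ℤ.* q ℤ.+ j ℤ.* (+ 2 ℤ.* r)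
    push = solve-∀
    pull : ∀ i j x q → + 2 ℤ.* i ℤ.* q ℤ.+ j ℤ.* (x ℤ.* q) ≡ (+ 2 ℤ.* i ℤ.+ j ℤ.* x) ℤ.* q
    pull = solve-∀

  -- The Cartan integer of ia+jb against a is 2i plus j times that of b. For i ≥ 2 and an angle that
  -- is not obtuse it is at least 4, beyond the bound 3.
  acute-excludesˡ : ∀ {a b} → 0ℤ ℤ.≤ B a b → ∀ i j → 2 ℕ.≤ i → ¬ (lin (+ i) (+ j) (root a) (root b) ∈Φ)
  acute-excludesˡ {a} {b} 0≤B i j 2≤i (c , eq) = big (cartan b a) (0≤B⇒0≤cartan b a (subst (0ℤ ℤ.≤_) (B-sym a b) 0≤B))
      (subst (λ z → ℤ.∣ z ∣ ℕ.≤ 3) (cartan-lin (+ i) (+ j) {a} {b} {c} eq) (cartan-bound c a))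
    where
    big : ∀ x → 0ℤ ℤ.≤ x → ℤ.∣ + 2 ℤ.* + i ℤ.+ + j ℤ.* x ∣ ℕ.≤ 3 → ⊥
    big (+ x) _ le = ℕₚ.<⇒≱ {3} {4} ℕₚ.≤-refl (ℕₚ.≤-trans (ℕₚ.≤-trans (ℕₚ.*-monoʳ-≤ 2 2≤i) (ℕₚ.m≤m+n (2 ℕ.* i) (j ℕ.* x)))
      (subst (ℕ._≤ 3) (cong ℤ.∣_∣ (trans (cong₂ ℤ._+_ (sym (ℤₚ.pos-* 2 i)) (sym (ℤₚ.pos-* j x))) (sym (ℤₚ.pos-+ (2 ℕ.* i) (j ℕ.* x))))) le))

  acute-excludesʳ : ∀ {a b} → 0ℤ ℤ.≤ B a b → ∀ i j → 2 ℕ.≤ j → ¬ (lin (+ i) (+ j) (root a) (root b) ∈Φ)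
  acute-excludesʳ {a} {b} 0≤B i j 2≤j (c , eq) = acute-excludesˡ {b} {a} (subst (0ℤ ℤ.≤_) (B-sym a b) 0≤B) j i 2≤j
    (c , trans eq (lin-swap (+ i) (+ j) (root a) (root b)))

  -- For b = a the sum would have Cartan integer 4 against a; for b = -a it would be 0.
  sum⇒independent : ∀ {a b} → (root a +v root b) ∈Φ → Independent a b
  sum⇒independent {a} {b} (d , eq) = independent
      (λ b≡a → ℕₚ.<⇒≱ {3} {4} ℕₚ.≤-refl (subst (λ z → ℤ.∣ z ∣ ℕ.≤ 3) (trans (cartan-lin 1ℤ 1ℤ {a} {a} {d} (trans eq (trans (cong (root a +v_) b≡a) (+v≡lin (root a) (root a)))))
                 (cong (λ z → + 2 ℤ.* 1ℤ ℤ.+ 1ℤ ℤ.* z) (cartan-unique a a (+ 2) refl))) (cartan-bound d a)))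
      (λ b≡-a → nonzero d (trans eq (trans (cong (root a +v_) b≡-a) (+v-inverseʳ (root a)))))

  lin≢0 : ∀ {a b} → Independent a b → ∀ i j → j ≢ 0ℤ → lin i j (root a) (root b) ≢ 0v
  lin≢0 {a} {b} ind i j j≢0 eq = [ Independent.≢+ ind , Independent.≢- ind ]′
    (reduced a b (ℤ.- i) j j≢0 (lin-0⇒·v j (ℤ.- i) (root b) (root a)
      (trans (cong (λ z → lin j z (root b) (root a)) (ℤₚ.neg-involutive i)) (trans (lin-swap j i (root b) (root a)) eq))))

  -- The Gram matrix of the pair is (q/2)·[[2A, C], [C, 2D]].
  record Gram (a b : Fin N) (A C D : ℤ) : Set where
    constructor gram
    field
      q   : ℤ
      q>0 : 0ℤ ℤ.< q
      Qa  : B a a ≡ A ℤ.* q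
      2B  : + 2 ℤ.* B a b ≡ C ℤ.* q
      Qb  : B b b ≡ D ℤ.* q

  -- Twice the inner product of ia+jb and ka+lb in units of `q`. The doubling is due to `C`, which
  -- stands for 2(a,b)/q and is odd in types A₂ and G₂.
  form : (A C D i j k l : ℤ) → ℤ
  form A C D i j k l = + 2 ℤ.* (i ℤ.* k) ℤ.* A ℤ.+ (i ℤ.* l ℤ.+ j ℤ.* k) ℤ.* C ℤ.+ + 2 ℤ.* (j ℤ.* l) ℤ.* D

  module _ {a b A C D} (g : Gram a b A C D) where
    open Gram g

    B-form : ∀ {i j k l c d} → root c ≡ lin i j (root a) (root b) → root d ≡ lin k l (root a) (root b) →
             + 2 ℤ.* B c d ≡ form A C D i j k l ℤ.* q
    B-form {i} {j} {k} {l} {c} {d} ec ed = begin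
      + 2 ℤ.* B c d
        ≡⟨ cong (+ 2 ℤ.*_) (B-lin i j {a} {b} {c} ec d) ⟩
      + 2 ℤ.* (i ℤ.* B a d ℤ.+ j ℤ.* B b d)
        ≡⟨ cong₂ (λ y z → + 2 ℤ.* (i ℤ.* y ℤ.+ j ℤ.* z)) (trans (B-sym a d) (B-lin k l {a} {b} {d} ed a)) (trans (B-sym b d) (B-lin k l {a} {b} {d} ed b)) ⟩
      + 2 ℤ.* (i ℤ.* (k ℤ.* B a a ℤ.+ l ℤ.* B b a) ℤ.+ j ℤ.* (k ℤ.* B a b ℤ.+ l ℤ.* B b b))
        ≡⟨ cong (λ z → + 2 ℤ.* (i ℤ.* (k ℤ.* B a a ℤ.+ l ℤ.* z) ℤ.+ j ℤ.* (k ℤ.* B a b ℤ.+ l ℤ.* B b b))) (B-sym b a) ⟩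
      + 2 ℤ.* (i ℤ.* (k ℤ.* B a a ℤ.+ l ℤ.* B a b) ℤ.+ j ℤ.* (k ℤ.* B a b ℤ.+ l ℤ.* B b b))
        ≡⟨ collect i j k l (B a a) (B a b) (B b b) ⟩
      + 2 ℤ.* (i ℤ.* k) ℤ.* B a a ℤ.+ (i ℤ.* l ℤ.+ j ℤ.* k) ℤ.* (+ 2 ℤ.* B a b) ℤ.+ + 2 ℤ.* (j ℤ.* l) ℤ.* B b b
        ≡⟨ cong₂ ℤ._+_ (cong₂ (λ y z → + 2 ℤ.* (i ℤ.* k) ℤ.* y ℤ.+ (i ℤ.* l ℤ.+ j ℤ.* k) ℤ.* z) Qa 2B) (cong (λ z → + 2 ℤ.* (j ℤ.* l) ℤ.* z) Qb) ⟩
      + 2 ℤ.* (i ℤ.* k) ℤ.* (A ℤ.* q) ℤ.+ (i ℤ.* l ℤ.+ j ℤ.* k) ℤ.* (C ℤ.* q) ℤ.+ + 2 ℤ.* (j ℤ.* l) ℤ.* (D ℤ.* q)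
        ≡⟨ factor i j k l A C D q ⟩
      form A C D i j k l ℤ.* q ∎
      where
      open ≡-Reasoning
      collect : ∀ i j k l u v w → + 2 ℤ.* (i ℤ.* (k ℤ.* u ℤ.+ l ℤ.* v) ℤ.+ j ℤ.* (k ℤ.* v ℤ.+ l ℤ.* w))
              ≡ + 2 ℤ.* (i ℤ.* k) ℤ.* u ℤ.+ (i ℤ.* l ℤ.+ j ℤ.* k) ℤ.* (+ 2 ℤ.* v) ℤ.+ + 2 ℤ.* (j ℤ.* l) ℤ.* w
      collect = solve-∀
      factor : ∀ i j k l A C D q → + 2 ℤ.* (i ℤ.* k) ℤ.* (A ℤ.* q) ℤ.+ (i ℤ.* l ℤ.+ j ℤ.* k) ℤ.* (C ℤ.* q) ℤ.+ + 2 ℤ.* (j ℤ.* l) ℤ.* (D ℤ.* q)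
             ≡ (+ 2 ℤ.* (i ℤ.* k) ℤ.* A ℤ.+ (i ℤ.* l ℤ.+ j ℤ.* k) ℤ.* C ℤ.+ + 2 ℤ.* (j ℤ.* l) ℤ.* D) ℤ.* q
      factor = solve-∀

    -- If c = ia+jb were a root, the bound 3 on its Cartan integer against the root d = ka+lb would
    -- contradict the inequality. The absence of a root thus becomes a comparison of numerals.
    excluded : ∀ i j k l {d} → root d ≡ lin k l (root a) (root b) →
               3 ℕ.* ℤ.∣ form A C D k l k l ∣ ℕ.< ℤ.∣ + 2 ℤ.* form A C D i j k l ∣ →
               ¬ (lin i j (root a) (root b) ∈Φ)
    excluded i j k l {d} ed lt (c , ec) = ℕₚ.<⇒≱ lt (subst (ℕ._≤ 3 ℕ.* ℤ.∣ form A C D k l k l ∣)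
        (trans (sym (ℤₚ.abs-* (cartan c d) (form A C D k l k l))) (cong ℤ.∣_∣ eq))
        (ℕₚ.*-monoˡ-≤ ℤ.∣ form A C D k l k l ∣ (cartan-bound c d)))
      where
      open ≡-Reasoning
      eq : cartan c d ℤ.* form A C D k l k l ≡ + 2 ℤ.* form A C D i j k l
      eq = ℤₚ.*-cancelʳ-≡ _ _ q {{ℤ.≢-nonZero (λ q≡0 → ℤₚ.<-irrefl (sym q≡0) q>0)}} (begin
        cartan c d ℤ.* form A C D k l k l ℤ.* q     ≡⟨ ℤₚ.*-assoc (cartan c d) (form A C D k l k l) q ⟩
        cartan c d ℤ.* (form A C D k l k l ℤ.* q)   ≡⟨ cong (cartan c d ℤ.*_) (B-form {k} {l} {k} {l} {d} {d} ed ed) ⟨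
        cartan c d ℤ.* (+ 2 ℤ.* B d d)              ≡⟨ swap2 (cartan c d) (B d d) ⟩
        + 2 ℤ.* (cartan c d ℤ.* B d d)              ≡⟨ cong (+ 2 ℤ.*_) (cartan-def-B c d) ⟩
        + 2 ℤ.* (+ 2 ℤ.* B c d)                     ≡⟨ cong (+ 2 ℤ.*_) (B-form {i} {j} {k} {l} {c} {d} ec ed) ⟩
        + 2 ℤ.* (form A C D i j k l ℤ.* q)          ≡⟨ ℤₚ.*-assoc (+ 2) (form A C D i j k l) q ⟨
        + 2 ℤ.* form A C D i j k l ℤ.* q            ∎)
        where
        swap2 : ∀ x y → x ℤ.* (+ 2 ℤ.* y) ≡ + 2 ℤ.* (x ℤ.* y)
        swap2 = solve-∀

  -- In `B₂` and `G₂` the first root is the short one; the primed constructors exchange the two.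
  -- `A₂` records only a Gram matrix, which also occurs for two short roots inside a system of type
  -- G₂.
  data Angle (a b : Fin N) : Set where
    acute : 0ℤ ℤ.≤ B a b → Angle a b
    A₂    : Gram a b 1ℤ -1ℤ 1ℤ → Angle a b
    B₂    : Gram a b 1ℤ (ℤ.- + 2) (+ 2) → Angle a b
    B₂′   : Gram b a 1ℤ (ℤ.- + 2) (+ 2) → Angle a b
    G₂    : Gram a b 1ℤ (ℤ.- + 3) (+ 3) → Angle a b
    G₂′   : Gram b a 1ℤ (ℤ.- + 3) (+ 3) → Angle a b

  mkGram : ∀ a b x → cartan b a ≡ x → cartan a b ≡ -1ℤ → Gram a b 1ℤ x (ℤ.- x)
  mkGram a b x ba≡x ab≡-1 = gram (B a a) (Q>0 a) (sym (ℤₚ.*-identityˡ (B a a)))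
    (trans (cong (+ 2 ℤ.*_) (B-sym a b)) (trans (sym (cartan-def-B b a)) (cong (ℤ._* B a a) ba≡x)))
    (begin
      B b b                          ≡⟨ negneg (B b b) ⟩
      ℤ.- (-1ℤ ℤ.* B b b)            ≡⟨ cong (λ z → ℤ.- (z ℤ.* B b b)) ab≡-1 ⟨
      ℤ.- (cartan a b ℤ.* B b b)     ≡⟨ cong ℤ.-_ (cartan-sym a b) ⟨
      ℤ.- (cartan b a ℤ.* B a a)     ≡⟨ cong (λ z → ℤ.- (z ℤ.* B a a)) ba≡x ⟩
      ℤ.- (x ℤ.* B a a)              ≡⟨ ℤₚ.neg-distribˡ-* x (B a a) ⟩
      ℤ.- x ℤ.* B a a                ∎)
    where
    open ≡-Reasoning
    negneg : ∀ z → z ≡ ℤ.- (-1ℤ ℤ.* z)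
    negneg = solve-∀

  angle : ∀ a b → Independent a b → Angle a b
  angle a b ind with 0ℤ ℤ.≤? B a b
  ... | yes 0≤B = acute 0≤B
  ... | no  B<0 = obtuse (cartan b a) (cartan a b) refl refl
        (cartan<0 b a (subst (ℤ._< 0ℤ) (B-sym a b) (ℤₚ.≰⇒> B<0))) (cartan<0 a b (ℤₚ.≰⇒> B<0)) (cartan-product<4 ind)
    where
    cartan<0 : ∀ a b → B a b ℤ.< 0ℤ → cartan a b ℤ.< 0ℤ
    cartan<0 a b B<0 = ℤₚ.*-cancelʳ-<-nonNeg (B b b) {{ℤ.nonNegative (ℤₚ.<⇒≤ (Q>0 b))}}
      (subst (ℤ._< 0ℤ ℤ.* B b b) (sym (cartan-def-B a b)) (subst (+ 2 ℤ.* B a b ℤ.<_) (sym (ℤₚ.*-zeroˡ (B b b))) (ℤₚ.*-monoˡ-<-pos (+ 2) B<0)))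
    obtuse : ∀ x y → cartan b a ≡ x → cartan a b ≡ y → x ℤ.< 0ℤ → y ℤ.< 0ℤ → x ℤ.* y ℤ.< + 4 → Angle a b
    obtuse -[1+ 0 ] -[1+ 0 ] ex ey _ _ _ = A₂ (mkGram a b -1ℤ ex ey)
    obtuse -[1+ 1 ] -[1+ 0 ] ex ey _ _ _ = B₂ (mkGram a b (ℤ.- + 2) ex ey)
    obtuse -[1+ 2 ] -[1+ 0 ] ex ey _ _ _ = G₂ (mkGram a b (ℤ.- + 3) ex ey)
    obtuse -[1+ 0 ] -[1+ 1 ] ex ey _ _ _ = B₂′ (mkGram b a (ℤ.- + 2) ey ex)
    obtuse -[1+ 0 ] -[1+ 2 ] ex ey _ _ _ = G₂′ (mkGram b a (ℤ.- + 3) ey ex)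
    obtuse -[1+ suc (suc (suc i)) ] -[1+ j ] _ _ _ _ (+<+ lt) =
      ⊥-elim (ℕₚ.<⇒≱ lt (ℕₚ.*-mono-≤ {4} {4 ℕ.+ i} {1} {suc j} (s≤s (s≤s (s≤s (s≤s z≤n)))) (s≤s z≤n)))
    obtuse -[1+ 0 ] -[1+ suc (suc (suc j)) ] _ _ _ _ (+<+ lt) =
      ⊥-elim (ℕₚ.<⇒≱ lt (ℕₚ.*-mono-≤ {1} {1} {4} {4 ℕ.+ j} ℕₚ.≤-refl (s≤s (s≤s (s≤s (s≤s z≤n))))))
    obtuse -[1+ suc i ] -[1+ suc j ] _ _ _ _ (+<+ lt) =
      ⊥-elim (ℕₚ.<⇒≱ lt (ℕₚ.*-mono-≤ {2} {2 ℕ.+ i} {2} {2 ℕ.+ j} (s≤s (s≤s z≤n)) (s≤s (s≤s z≤n))))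
    obtuse (+ _)    _     _ _ (+<+ ()) _ _
    obtuse -[1+ _ ] (+ _) _ _ _ (+<+ ()) _

  -- For r ≥ 3 the roots a+b and b-3a would have Cartan integers against a that differ by 8, while
  -- two integers bounded by 3 differ by at most 6. Hence the structure constant r+1 is at most 3.
  string<3 : ∀ {a b} r → (root a +v root b) ∈Φ →
    (∀ i → i ℕ.≤ r → (root b +v (-v ((+ i) ·v root a))) ∈Φ) → r ℕ.< 3
  string<3 {a} {b} r (d , ed) string = ℕₚ.≰⇒> λ 3≤r → impossible (string 3 3≤r)
    where
    x = cartan b a
    diff : ∀ x → (+ 2 ℤ.* 1ℤ ℤ.+ 1ℤ ℤ.* x) ℤ.- (+ 2 ℤ.* (ℤ.- + 3) ℤ.+ 1ℤ ℤ.* x) ≡ + 8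
    diff = solve-∀
    impossible : (root b +v (-v ((+ 3) ·v root a))) ∈Φ → ⊥
    impossible (c , ec) = ℕₚ.<⇒≱ {6} {8} (s≤s (s≤s (s≤s (s≤s (s≤s (s≤s (s≤s z≤n))))))) (subst (λ z → ℤ.∣ z ∣ ℕ.≤ 6) eq
      (ℕₚ.≤-trans (ℤₚ.∣i-j∣≤∣i∣+∣j∣ (cartan d a) (cartan c a)) (ℕₚ.+-mono-≤ (cartan-bound d a) (cartan-bound c a))))
      where
      eq : cartan d a ℤ.- cartan c a ≡ + 8
      eq = trans (cong₂ ℤ._-_ (cartan-lin 1ℤ 1ℤ {a} {b} {d} (trans ed (+v≡lin (root a) (root b))))
                              (cartan-lin (ℤ.- + 3) 1ℤ {a} {b} {c} (trans ec (trans (sub≡lin (+ 3) (root b) (root a)) (lin-swap 1ℤ (ℤ.- + 3) (root b) (root a))))))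
                 (diff x)

  minus⇒plus : ∀ {a b c} → root c ≡ lin 1ℤ -1ℤ (root a) (root b) → root a ≡ root c +v root b
  minus⇒plus {a} {b} {c} eq = sym (begin
    root c +v root b                                ≡⟨ +v≡lin (root c) (root b) ⟩
    lin 1ℤ 1ℤ (root c) (root b)                     ≡⟨ cong₂ (lin 1ℤ 1ℤ) eq (sym (lin-01 (root a) (root b))) ⟩
    lin 1ℤ 1ℤ (lin 1ℤ -1ℤ (root a) (root b)) (lin 0ℤ 1ℤ (root a) (root b))
                                                    ≡⟨ lin-lin 1ℤ 1ℤ 1ℤ -1ℤ 0ℤ 1ℤ (root a) (root b) ⟩
    lin 1ℤ 0ℤ (root a) (root b)                     ≡⟨ lin-10 (root a) (root b) ⟩
    root a                                          ∎)
    where open ≡-Reasoning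

  +v-cancelˡ : ∀ {n} (u v w : ZVec n) → u +v v ≡ u +v w → v ≡ w
  +v-cancelˡ []      []      []      _  = refl
  +v-cancelˡ (a ∷ u) (b ∷ v) (c ∷ w) eq = cong₂ _∷_ (ℤGroup.∙-cancelˡ a b c (cong Vec.head eq)) (+v-cancelˡ u v w (cong Vec.tail eq))

  -- A nonnegative combination of roots that is a root is reached by adding one summand at a time:
  -- 0 < (γ, γ) forces a summand s with (γ, s) > 0, and then γ - s is a root unless γ = s.
  peel : ∀ {k} (s : Fin k → Fin N) (P : Fin N → Set) → (∀ i → P (s i)) →
         (∀ {a c} i → root a ≡ root c +v root (s i) → P c → P a) →
         ∀ m c a → sumℕ c ≡ m → root a ≡ sumℕV c (λ i → root (s i)) → P a
  peel s P base step m c a sum eq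
    with positive-term c (λ i → B (s i) a) (subst (0ℤ ℤ.<_) (B-sum s c eq) (Q>0 a))
  ... | i , c>0 , 0<B with root a ≟v root (s i)
  ...   | yes a≡s = subst P (sym (root-inj a≡s)) (base i)
  ...   | no a≢s with difference a (s i) (subst (0ℤ ℤ.<_) (B-sym (s i) a) 0<B) a≢s | remove-one c (λ i → root (s i)) i c>0
  peel s P base step zero    c a sum eq | i , c>0 , 0<B | no a≢s | d , ed | c′ , eq′ , sum′ with trans (sym sum) sum′
  ... | ()
  peel s P base step (suc m) c a sum eq | i , c>0 , 0<B | no a≢s | d , ed | c′ , eq′ , sum′ =
    step i a≡d+s (peel s P base step m c′ d (ℕₚ.suc-injective (trans (sym sum′) sum))
      (+v-cancelˡ (root (s i)) _ _ (trans (+v-comm (root (s i)) (root d)) (trans (sym a≡d+s) (trans eq eq′)))))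
    where
    a≡d+s : root a ≡ root d +v root (s i)
    a≡d+s = minus⇒plus {a} {s i} {d} ed

  -- A root b ≠ a at an acute angle gives a = (a-b)+b. If there is none, then for b ≠ ±a both b and
  -- -b pair nonpositively with a, so b is orthogonal to a; irreducibility then leaves only ±a. The
  -- three distinct values of `s` contradict this.
  two-summands : ∀ {k} (s : Fin (3 ℕ.+ k) → Fin N) → Injective _≡_ _≡_ s →
                 ∀ a → ∃₂ λ b c → root a ≡ root b +v root c
  two-summands s s-inj a with Finₚ.any? (λ b → (0ℤ ℤ.<? B a b) ×-dec ¬? (root b ≟v root a))
  ... | yes (b , 0<B , b≢a) with difference a b 0<B (b≢a ∘ sym)
  ...   | c , ec = c , b , minus⇒plus {a} {b} {c} ec
  two-summands s s-inj a | no none = ⊥-elim (case-all (irreducible P λ b c Pb≢Pc → trans (sym (B≡bil b c)) (orthogonal b c Pb≢Pc)))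
    where
    ±a? : ∀ b → Dec (root b ≡ root a ⊎ root b ≡ -v root a)
    ±a? b = (root b ≟v root a) ⊎-dec (root b ≟v (-v root a))
    P : Fin N → Bool
    P b = does (±a? b)
    B≤0 : ∀ b → root b ≢ root a → B a b ℤ.≤ 0ℤ
    B≤0 b b≢a = ℤₚ.≮⇒≥ λ 0<B → none (b , 0<B , b≢a)
    B≡0 : ∀ b → ¬ (root b ≡ root a ⊎ root b ≡ -v root a) → B a b ≡ 0ℤ
    B≡0 b b≢ = ℤₚ.≤-antisym (B≤0 b (b≢ ∘ inj₁)) (ℤₚ.neg-cancel-≤ (subst (ℤ._≤ 0ℤ) (B-neg a b) (B≤0 (neg b) -b≢a)))
      where
      -b≢a : root (neg b) ≢ root a
      -b≢a eq = b≢ (inj₂ (trans (sym (-v-involutive (root b))) (cong -v_ (trans (sym (root-neg′ b)) eq))))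
    ±a⇒B≡0 : ∀ b c → root b ≡ root a ⊎ root b ≡ -v root a → ¬ (root c ≡ root a ⊎ root c ≡ -v root a) → B b c ≡ 0ℤ
    ±a⇒B≡0 b c (inj₁ eq) c≢ = trans (≡⇒B {a} {b} eq c) (B≡0 c c≢)
    ±a⇒B≡0 b c (inj₂ eq) c≢ = trans (≡-v⇒B {a} {b} eq c) (cong ℤ.-_ (B≡0 c c≢))
    orthogonal : ∀ b c → P b ≢ P c → B b c ≡ 0ℤ
    orthogonal b c Pb≢Pc with ±a? b | ±a? c
    ... | yes b≡ | yes c≡ = ⊥-elim (Pb≢Pc (trans (dec-true (±a? b) b≡) (sym (dec-true (±a? c) c≡))))
    ... | no b≢  | no c≢  = ⊥-elim (Pb≢Pc (trans (dec-false (±a? b) b≢) (sym (dec-false (±a? c) c≢))))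
    ... | yes b≡ | no c≢  = ±a⇒B≡0 b c b≡ c≢
    ... | no b≢  | yes c≡ = trans (B-sym b c) (±a⇒B≡0 c b c≡ b≢)
    P⇒ : ∀ b → P b ≡ true → root b ≡ root a ⊎ root b ≡ -v root a
    P⇒ b Pb = decidable-stable (±a? b) λ b≢ → true≢false (trans (sym Pb) (dec-false (±a? b) b≢))
      where
      true≢false : true ≢ false
      true≢false ()
    i₀ i₁ i₂ : Fin _
    i₀ = Fin.zero
    i₁ = Fin.suc Fin.zero
    i₂ = Fin.suc (Fin.suc Fin.zero)
    same : ∀ {i j v} → i ≢ j → root (s i) ≡ v → root (s j) ≡ v → ⊥
    same i≢j ei ej = i≢j (s-inj (root-inj (trans ei (sym ej))))
    case-all : (∀ b → P b ≡ true) ⊎ (∀ b → P b ≡ false) → ⊥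
    case-all (inj₂ allF) with trans (sym (dec-true (±a? a) (inj₁ refl))) (allF a)
    ... | ()
    case-all (inj₁ allT) with P⇒ (s i₀) (allT (s i₀)) | P⇒ (s i₁) (allT (s i₁)) | P⇒ (s i₂) (allT (s i₂))
    ... | inj₁ e₀ | inj₁ e₁ | _       = same {i₀} {i₁} (λ ()) e₀ e₁
    ... | inj₂ e₀ | inj₂ e₁ | _       = same {i₀} {i₁} (λ ()) e₀ e₁
    ... | inj₁ e₀ | inj₂ e₁ | inj₁ e₂ = same {i₀} {i₂} (λ ()) e₀ e₂
    ... | inj₁ e₀ | inj₂ e₁ | inj₂ e₂ = same {i₁} {i₂} (λ ()) e₁ e₂
    ... | inj₂ e₀ | inj₁ e₁ | inj₁ e₂ = same {i₁} {i₂} (λ ()) e₁ e₂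
    ... | inj₂ e₀ | inj₁ e₁ | inj₂ e₂ = same {i₀} {i₂} (λ ()) e₀ e₂

-- Words in the Steinberg generators

module Search {n} (R : RootSystem n) where
  open RS R

  search : ∀ {k} → ZVec n → (Fin k → ZVec n) → Maybe (Fin k)
  search {zero}  v r = nothing
  search {suc k} v r = if does (r Fin.zero ≟v v) then just Fin.zero
                       else Maybe.map Fin.suc (search v (r ∘ Fin.suc))

  -- The recursion inside findRoot has no accessible name; it is recovered by unification
  -- as the left-hand side of go≡search.
  mutual
    findRoot≡search : ∀ v → findRoot v ≡ search v root
    findRoot≡search v with N | root
    ... | k | r = go≡search v k r

    go≡search : ∀ v k (r : Fin k → ZVec n) → _ ≡ search v r
    go≡search v zero    r = refl
    go≡search v (suc k) r = cong (λ z → if does (r Fin.zero ≟v v) then just Fin.zero else Maybe.map Fin.suc z)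
                                 (go≡search v k (r ∘ Fin.suc))

  Found : ∀ {k} → ZVec n → (Fin k → ZVec n) → Maybe (Fin k) → Set
  Found v r (just g) = r g ≡ v
  Found v r nothing  = ∀ g → r g ≢ v

  search-found : ∀ {k} v (r : Fin k → ZVec n) → Found v r (search v r)
  search-found {zero}  v r ()
  search-found {suc k} v r with r Fin.zero ≟v v
  ... | yes eq = eq
  ... | no neq with search v (r ∘ Fin.suc) | search-found v (r ∘ Fin.suc)
  ...   | just g  | eq   = eq
  ...   | nothing | none = λ { Fin.zero → neq ; (Fin.suc g) → none g }

  findRoot-found : ∀ v → Found v root (findRoot v)
  findRoot-found v = subst (Found v root) (sym (findRoot≡search v)) (search-found v root)

lin-+ : ∀ {n} i j k l (u v : ZVec n) → lin i j u v +v lin k l u v ≡ lin (i ℤ.+ k) (j ℤ.+ l) u v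
lin-+ i j k l u v = trans (+v≡lin (lin i j u v) (lin k l u v)) (trans (lin-lin 1ℤ 1ℤ i j k l u v)
  (cong₂ (λ y z → lin y z u v) (cong₂ ℤ._+_ (ℤₚ.*-identityˡ i) (ℤₚ.*-identityˡ k)) (cong₂ ℤ._+_ (ℤₚ.*-identityˡ j) (ℤₚ.*-identityˡ l))))

module Steinberg (p : ℕ) .{{_ : NonZero p}} (m : ℕ) (fl : Vec (Fin p) m)
                 {n : ℕ} (R : RootSystem n) (CB : ChevalleyBasis R) where
  open RS R
  open ChevalleyBasis CB
  open Field p m fl
  open FieldMul p m fl
  open Chevalley p m fl R CB
  open RootGeometry R
  open Search R

  private
    X′ : ZVec n → 𝔽 → Word
    X′ v w with findRoot v
    ... | nothing = []
    ... | just g  = x g w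

    T′ : Fin N → Fin N → 𝔽 → 𝔽 → ℕ → ℕ → Word
    T′ a b t u i j = X′ (lin (+ i) (+ j) (root a) (root b)) ((ι (C (root a) (root b) i j) *F (t ^F i)) *F (u ^F j))

    -- As for findRoot, the local function of commProd is only reachable by unification.
    mutual
      commProd≡′ : ∀ a b t u → commProd a b t u ≡ T′ a b t u 1 1 ++ T′ a b t u 2 1 ++ T′ a b t u 1 2 ++ T′ a b t u 3 1 ++ T′ a b t u 2 2 ++ T′ a b t u 1 3 ++ T′ a b t u 3 2 ++ T′ a b t u 2 3 ++ []
      commProd≡′ a b t u with findRoot (lin (+ 1) (+ 1) (root a) (root b))
      ... | nothing = tail1 a b t u
      ... | just _ = cong₂ _∷_ refl (tail1 a b t u)
      tail1 : ∀ a b t u → _ ≡ T′ a b t u 2 1 ++ T′ a b t u 1 2 ++ T′ a b t u 3 1 ++ T′ a b t u 2 2 ++ T′ a b t u 1 3 ++ T′ a b t u 3 2 ++ T′ a b t u 2 3 ++ []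
      tail1 a b t u with findRoot (lin (+ 2) (+ 1) (root a) (root b))
      ... | nothing = tail2 a b t u
      ... | just _ = cong₂ _∷_ refl (tail2 a b t u)
      tail2 : ∀ a b t u → _ ≡ T′ a b t u 1 2 ++ T′ a b t u 3 1 ++ T′ a b t u 2 2 ++ T′ a b t u 1 3 ++ T′ a b t u 3 2 ++ T′ a b t u 2 3 ++ []
      tail2 a b t u with findRoot (lin (+ 1) (+ 2) (root a) (root b))
      ... | nothing = tail3 a b t u
      ... | just _ = cong₂ _∷_ refl (tail3 a b t u)
      tail3 : ∀ a b t u → _ ≡ T′ a b t u 3 1 ++ T′ a b t u 2 2 ++ T′ a b t u 1 3 ++ T′ a b t u 3 2 ++ T′ a b t u 2 3 ++ []
      tail3 a b t u with findRoot (lin (+ 3) (+ 1) (root a) (root b))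
      ... | nothing = tail4 a b t u
      ... | just _ = cong₂ _∷_ refl (tail4 a b t u)
      tail4 : ∀ a b t u → _ ≡ T′ a b t u 2 2 ++ T′ a b t u 1 3 ++ T′ a b t u 3 2 ++ T′ a b t u 2 3 ++ []
      tail4 a b t u with findRoot (lin (+ 2) (+ 2) (root a) (root b))
      ... | nothing = tail5 a b t u
      ... | just _ = cong₂ _∷_ refl (tail5 a b t u)
      tail5 : ∀ a b t u → _ ≡ T′ a b t u 1 3 ++ T′ a b t u 3 2 ++ T′ a b t u 2 3 ++ []
      tail5 a b t u with findRoot (lin (+ 1) (+ 3) (root a) (root b))
      ... | nothing = tail6 a b t u
      ... | just _ = cong₂ _∷_ refl (tail6 a b t u)
      tail6 : ∀ a b t u → _ ≡ T′ a b t u 3 2 ++ T′ a b t u 2 3 ++ []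
      tail6 a b t u with findRoot (lin (+ 3) (+ 2) (root a) (root b))
      ... | nothing = tail7 a b t u
      ... | just _ = cong₂ _∷_ refl (tail7 a b t u)
      tail7 : ∀ a b t u → _ ≡ T′ a b t u 2 3 ++ []
      tail7 a b t u with findRoot (lin (+ 2) (+ 3) (root a) (root b))
      ... | nothing = refl
      ... | just _ = refl

  opaque
    -- Root elements extended by the empty word to vectors that are not roots. The commutator
    -- formula then has the same eight factors for every pair, and `X-nonroot` removes the trivial
    -- ones.
    X : ZVec n → 𝔽 → Word
    X = X′

    mono : Fin N → Fin N → 𝔽 → 𝔽 → ℕ → ℕ → 𝔽
    mono a b t u i j = (ι (C (root a) (root b) i j) *F (t ^F i)) *F (u ^F j)

    mono≡ : ∀ a b t u i j → mono a b t u i j ≡ (ι (C (root a) (root b) i j) *F (t ^F i)) *F (u ^F j)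
    mono≡ a b t u i j = refl

  T : Fin N → Fin N → 𝔽 → 𝔽 → ℕ → ℕ → Word
  T a b t u i j = X (lin (+ i) (+ j) (root a) (root b)) (mono a b t u i j)

  opaque
    unfolding X mono

    commProd≡ : ∀ a b t u → let T = T a b t u in
      commProd a b t u ≡ T 1 1 ++ T 2 1 ++ T 1 2 ++ T 3 1 ++ T 2 2 ++ T 1 3 ++ T 3 2 ++ T 2 3 ++ []
    commProd≡ = commProd≡′

    X-root : ∀ {g v} → root g ≡ v → ∀ w → X v w ≡ x g w
    X-root {g} {v} eq w with findRoot v | findRoot-found v
    ... | just h  | eq′  = cong (λ h → x h w) (root-inj (trans eq′ (sym eq)))
    ... | nothing | none = ⊥-elim (none g eq)

    X-nonroot : ∀ {v} → ¬ (v ∈Φ) → ∀ w → X v w ≡ []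
    X-nonroot {v} v∉Φ w with findRoot v | findRoot-found v
    ... | just h  | eq = ⊥-elim (v∉Φ (h , eq))
    ... | nothing | _  = refl

  X-elim : ∀ v (P : (𝔽 → Word) → Set) → (∀ {f g} → (∀ w → f w ≡ g w) → P f → P g) →
           P (λ _ → []) → (∀ g → root g ≡ v → P (x g)) → P (X v)
  X-elim v P resp none some with Finₚ.any? (λ g → root g ≟v v)
  ... | yes (g , g≡v) = resp (λ w → sym (X-root g≡v w)) (some g g≡v)
  ... | no v∉Φ        = resp (λ w → sym (X-nonroot v∉Φ w)) none

  invW : Word → Word
  invW []      = []
  invW (l ∷ w) = invW w ++ inv l ∷ []

  free′ : ∀ l → inv l ∷ l ∷ [] ≈ []
  free′ (true , g)  = free (false , g)
  free′ (false , g) = free (true , g)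

  ≡⇒≈ : ∀ {v w} → v ≡ w → v ≈ w
  ≡⇒≈ refl = ≈-refl

  invW-inverseʳ : ∀ w → w ++ invW w ≈ []
  invW-inverseʳ []      = ≈-refl
  invW-inverseʳ (l ∷ w) = ≈-trans
    (≈-cong {l ∷ []} ≈-refl (≈-trans (≡⇒≈ (sym (++-assoc w (invW w) (inv l ∷ [])))) (≈-cong (invW-inverseʳ w) ≈-refl)))
    (free l)

  invW-inverseˡ : ∀ w → invW w ++ w ≈ []
  invW-inverseˡ []      = ≈-refl
  invW-inverseˡ (l ∷ w) = ≈-trans (≡⇒≈ (++-assoc (invW w) (inv l ∷ []) (l ∷ w)))
    (≈-trans (≈-cong (≈-refl {invW w}) (≈-cong (free′ l) (≈-refl {w}))) (invW-inverseˡ w))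

  invW-cong : ∀ {v w} → v ≈ w → invW v ≈ invW w
  invW-cong {v} {w} v≈w =
    ≈-trans (≡⇒≈ (sym (++-identityʳ (invW v))))
    (≈-trans (≈-cong (≈-refl {invW v}) (≈-sym (≈-trans (≈-cong v≈w ≈-refl) (invW-inverseʳ w))))
    (≈-trans (≡⇒≈ (sym (++-assoc (invW v) v (invW w))))
             (≈-cong (invW-inverseˡ v) ≈-refl)))

  E : Group 0ℓ 0ℓ
  E = record
    { Carrier = Word
    ; _≈_ = _≈_
    ; _∙_ = _++_
    ; ε = []
    ; _⁻¹ = invW
    ; isGroup = record
      { isMonoid = record
        { isSemigroup = record
          { isMagma = record
            { isEquivalence = record { refl = ≈-refl ; sym = ≈-sym ; trans = ≈-trans }
            ; ∙-cong = ≈-cong }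
          ; assoc = λ u v w → ≡⇒≈ (++-assoc u v w) }
        ; identity = (λ w → ≈-refl) , (λ w → ≡⇒≈ (++-identityʳ w)) }
      ; inverse = invW-inverseˡ , invW-inverseʳ
      ; ⁻¹-cong = invW-cong }
    }

  open GroupLemmas E renaming (inverseʳ-unique to E-inverseʳ-unique; interchange to E-interchange; identityʳ-unique to E-identityʳ-unique; ⁻¹-involutive to E-⁻¹-involutive)

  x-0 : ∀ a → x a 0F ≈ []
  x-0 a = E-identityʳ-unique (x a 0F) (x a 0F) (≈-trans (rel-add a 0F 0F) (≡⇒≈ (cong (x a) (+-identityˡ 0F))))

  x-neg : ∀ a t → x a (-F t) ≈ invW (x a t)
  x-neg a t = E-inverseʳ-unique (x a t) (x a (-F t))
    (≈-trans (rel-add a t (-F t)) (≈-trans (≡⇒≈ (cong (x a) (-‿inverseʳ t))) (x-0 a)))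

  -- Links scalars in 𝔽_p to exponents in the group, so that scalars prime to `p` can be cancelled
  -- by `×-cancel`.
  x-scal : ∀ a k t → x a (scal [ k ] t) ≈ k ⊗ x a t
  x-scal a zero    t = ≈-trans (≡⇒≈ (cong (x a) (⊙-zeroˡ t))) (x-0 a)
  x-scal a (suc k) t = begin
    x a (scal [ suc k ] t)               ≈⟨ ≡⇒≈ (cong (λ c → x a (scal c t)) (+p-[] 1 k)) ⟨
    x a (scal ([ 1 ] +p [ k ]) t)        ≈⟨ ≡⇒≈ (cong (x a) (trans (⊙-distribʳ [ 1 ] [ k ] t) (cong (_+F scal [ k ] t) (⊙-identity t)))) ⟩
    x a (t +F scal [ k ] t)              ≈⟨ rel-add a t (scal [ k ] t) ⟨
    x a t ++ x a (scal [ k ] t)          ≈⟨ ≈-cong (≈-refl {x a t}) (x-scal a k t) ⟩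
    suc k ⊗ x a t                        ∎
    where open import Relation.Binary.Reasoning.Setoid (Group.setoid E)

  x-torsion : ∀ a t → p ⊗ x a t ≈ []
  x-torsion a t = ≈-trans (≈-sym (x-scal a p t)) (≈-trans (≡⇒≈ (cong (x a) (trans (cong (λ c → scal c t) [p]≡0p) (⊙-zeroˡ t)))) (x-0 a))

  ⊗-[] : ∀ k → k ⊗ [] ≈ []
  ⊗-[] zero    = ≈-refl
  ⊗-[] (suc k) = ⊗-[] k

  X-neg : ∀ v w → X v (-F w) ≈ invW (X v w)
  X-neg v w = X-elim v (λ f → f (-F w) ≈ invW (f w))
    (λ eq h → ≈-trans (≡⇒≈ (sym (eq _))) (≈-trans h (≡⇒≈ (cong invW (eq w)))))
    ≈-refl (λ g _ → x-neg g w)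

  X-scal : ∀ v k w → X v (scal [ k ] w) ≈ k ⊗ X v w
  X-scal v k w = X-elim v (λ f → f (scal [ k ] w) ≈ k ⊗ f w)
    (λ eq h → ≈-trans (≡⇒≈ (sym (eq _))) (≈-trans h (≡⇒≈ (cong (k ⊗_) (eq w)))))
    (≈-sym (⊗-[] k)) (λ g _ → x-scal g k w)

  X-torsion : ∀ v w → p ⊗ X v w ≈ []
  X-torsion v w = X-elim v (λ f → p ⊗ f w ≈ [])
    (λ eq h → ≈-trans (≡⇒≈ (cong (p ⊗_) (sym (eq w)))) h)
    (⊗-[] p) (λ g _ → x-torsion g w)

  module _ (a b : Fin N) (a+b≢0 : root a +v root b ≢ 0v) (t u : 𝔽) where

    acute-commutator : 0ℤ ℤ.≤ B a b → commW a b t u ≈ T a b t u 1 1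
    acute-commutator 0≤B = ≈-trans (rel-comm a b a+b≢0 t u) (≡⇒≈ (trans (commProd≡ a b t u)
      (trans (cong (T a b t u 1 1 ++_)
        (cong₂ _++_ (gone (acute-excludesˡ 0≤B 2 1 two))
        (cong₂ _++_ (gone (acute-excludesʳ 0≤B 1 2 two))
        (cong₂ _++_ (gone (acute-excludesˡ 0≤B 3 1 three))
        (cong₂ _++_ (gone (acute-excludesˡ 0≤B 2 2 two))
        (cong₂ _++_ (gone (acute-excludesʳ 0≤B 1 3 three))
        (cong₂ _++_ (gone (acute-excludesˡ 0≤B 3 2 three))
        (cong (_++ []) (gone (acute-excludesˡ 0≤B 2 3 two)))))))))) (++-identityʳ _))))
      where
      two : 2 ℕ.≤ 2
      two = ℕₚ.≤-refl
      three : 2 ℕ.≤ 3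
      three = s≤s (s≤s z≤n)
      gone : ∀ {v w} → ¬ (v ∈Φ) → X v w ≡ []
      gone v∉Φ = X-nonroot v∉Φ _

    -- An obtuse pair has a root as its sum, so this pair is not obtuse. Its commutator reduces to
    -- the factor at α+β, and that factor is empty too.
    x-commute : ¬ ((root a +v root b) ∈Φ) → Commute (x a t) (x b u)
    x-commute a+b∉Φ = ≈-trans (commutator⇒ {x a t} {x b u}
        (≈-trans (acute-commutator 0≤B) (≡⇒≈ (X-nonroot (subst (λ v → ¬ (v ∈Φ)) (+v≡lin (root a) (root b)) a+b∉Φ) _))))
        (≡⇒≈ (++-identityʳ _))
      where
      0≤B : 0ℤ ℤ.≤ B a b
      0≤B = ℤₚ.≮⇒≥ λ B<0 → a+b∉Φ (sum-root a b B<0 λ b≡-a → a+b≢0 (trans (cong (root a +v_) b≡-a) (+v-inverseʳ (root a))))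

  X-commute : ∀ {v v′} → v +v v′ ≢ 0v → ¬ ((v +v v′) ∈Φ) → ∀ w w′ → Commute (X v w) (X v′ w′)
  X-commute {v} {v′} ≢0 ∉Φ w w′ = X-elim v (λ f → Commute (f w) (X v′ w′))
    (λ eq → subst (λ z → Commute z (X v′ w′)) (eq w))
    (≈-sym (commute-ε (X v′ w′)))
    λ g g≡v → X-elim v′ (λ f → Commute (x g w) (f w′))
      (λ eq → subst (Commute (x g w)) (eq w′))
      (commute-ε (x g w))
      λ h h≡v′ → x-commute g h (subst₂ (λ y z → y +v z ≢ 0v) (sym g≡v) (sym h≡v′) ≢0) w w′
                   (subst₂ (λ y z → ¬ ((y +v z) ∈Φ)) (sym g≡v) (sym h≡v′) ∉Φ)

  module _ (a b : Fin N) (i j : ℕ) (t u : 𝔽) where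
    private
      c : 𝔽
      c = ι (C (root a) (root b) i j)

    opaque
      unfolding mono

      mono-neg₁ : ∀ t′ → t′ ^F i ≡ -F (t ^F i) → mono a b t′ u i j ≡ -F (mono a b t u i j)
      mono-neg₁ t′ eq = trans (cong (λ z → (c *F z) *F (u ^F j)) eq) (trans (cong (_*F (u ^F j)) (*F-negʳ c (t ^F i))) (*F-negˡ (c *F (t ^F i)) (u ^F j)))

      mono-neg₂ : ∀ u′ → u′ ^F j ≡ -F (u ^F j) → mono a b t u′ i j ≡ -F (mono a b t u i j)
      mono-neg₂ u′ eq = trans (cong ((c *F (t ^F i)) *F_) eq) (*F-negʳ (c *F (t ^F i)) (u ^F j))

      mono-cong₁ : ∀ t′ → t′ ^F i ≡ t ^F i → mono a b t′ u i j ≡ mono a b t u i j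
      mono-cong₁ t′ eq = cong (λ z → (c *F z) *F (u ^F j)) eq

      mono-cong₂ : ∀ u′ → u′ ^F j ≡ u ^F j → mono a b t u′ i j ≡ mono a b t u i j
      mono-cong₂ u′ eq = cong ((c *F (t ^F i)) *F_) eq

      mono-scal : ∀ k → mono a b (scal [ k ] t) u i j ≡ scal [ k ℕ.^ i ] (mono a b t u i j)
      mono-scal k = begin
        (c *F (scal [ k ] t ^F i)) *F (u ^F j)          ≡⟨ cong (λ z → (c *F z) *F (u ^F j)) ([c⊙t]^ k t i) ⟩
        (c *F scal [ k ℕ.^ i ] (t ^F i)) *F (u ^F j)    ≡⟨ cong (_*F (u ^F j)) (horner-⊙ c [ k ℕ.^ i ] (t ^F i)) ⟩
        scal [ k ℕ.^ i ] (c *F (t ^F i)) *F (u ^F j)    ≡⟨ *F-scalˡ [ k ℕ.^ i ] (c *F (t ^F i)) (u ^F j) ⟩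
        scal [ k ℕ.^ i ] (mono a b t u i j)             ∎
        where open ≡-Reasoning

-- The subgroup generated by a positively spanning set of roots

module Closure (p : ℕ) .{{_ : NonZero p}} (pr : Prime p) (3<p : 3 < p) (m : ℕ) (fl : Vec (Fin p) m)
               {n : ℕ} (R : RootSystem n) (CB : ChevalleyBasis R) where
  open RS R
  open ChevalleyBasis CB
  open Field p m fl
  open FieldMul p m fl
  open Chevalley p m fl R CB
  open RootGeometry R
  open Steinberg p m fl R CB
  open GroupLemmas E renaming (inverseʳ-unique to E-inverseʳ-unique; interchange to E-interchange; identityʳ-unique to E-identityʳ-unique; ⁻¹-involutive to E-⁻¹-involutive)

  -- Products of parameters in a subgroup

  module _ {P : Word → Set} (P-isSubgroup : IsSubgroup P) where
    open IsSubgroup P-isSubgroup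

    V : Fin N → 𝔽 → Set
    V a t = P (x a t)

    V-neg : ∀ {a t} → V a t → V a (-F t)
    V-neg {a} {t} h = respects (≈-sym (x-neg a t)) (⁻¹∈ h)

    V-+ : ∀ {a t u} → V a t → V a u → V a (t +F u)
    V-+ {a} {t} {u} h k = respects (rel-add a t u) (∙∈ h k)

    V-scal : ∀ {a t} k → V a t → V a (scal [ k ] t)
    V-scal {a} {t} k h = respects (≈-sym (x-scal a k t)) (×∈ k h)

    commProd∈ : ∀ {a b t u} → root a +v root b ≢ 0v → V a t → V b u → P (commProd a b t u)
    commProd∈ {a} {b} {t} {u} ≢0 ha hb = respects (rel-comm a b ≢0 t u) (∙∈ (⁻¹∈ ha) (∙∈ (⁻¹∈ hb) (∙∈ ha hb)))

    ⊗-cancel₂ : ∀ {v w} → P (2 ⊗ X v w) → P (X v w)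
    ⊗-cancel₂ {v} {w} = ×-cancel pr (X-torsion v w) 2 (ℕₚ.<-trans (s≤s (s≤s (s≤s z≤n))) 3<p)

    -- 24 = 3·2·2·2 is cancelled one prime at a time, because `×-cancel` asks for a number below `p`
    -- and 24 may exceed `p`.
    ⊗-cancel₂₄ : ∀ {v w} → P (24 ⊗ X v w) → P (X v w)
    ⊗-cancel₂₄ {v} {w} h =
      ⊗-cancel₂ (half 2 (half 4 (×-cancel pr (torsion 8) 3 3<p (respects (≈-sym (×-assocˡ y 3 8)) h))))
      where
      y = X v w
      torsion : ∀ k → p ⊗ (k ⊗ y) ≈ []
      torsion k = ≈-trans (×-assocˡ y p k) (≈-trans (×-congˡ (ℕₚ.*-comm p k)) (×-torsion (X-torsion v w) k))
      half : ∀ k → P ((2 ℕ.* k) ⊗ y) → P (k ⊗ y)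
      half k h = ×-cancel pr (torsion k) 2 (ℕₚ.<-trans (s≤s (s≤s (s≤s z≤n))) 3<p) (respects (≈-sym (×-assocˡ y 2 k)) h)

    module Pair {a b : Fin N} (a+b∈Φ : (root a +v root b) ∈Φ) where

      ind : Independent a b
      ind = sum⇒independent a+b∈Φ

      d : Fin N
      d = proj₁ a+b∈Φ

      root-d : root d ≡ lin 1ℤ 1ℤ (root a) (root b)
      root-d = trans (proj₂ a+b∈Φ) (+v≡lin (root a) (root b))

      a+b≢0 : root a +v root b ≢ 0v
      a+b≢0 eq = nonzero d (trans (proj₂ a+b∈Φ) eq)

      -- Writing the first coefficient of b as `suc j` gives the sum of the two vectors a positive
      -- coefficient of b. By independence this sum is not 0, as `X-commute` requires.
      T-commute : ∀ i j k l → ¬ (lin (+ (i ℕ.+ k)) (+ (suc j ℕ.+ l)) (root a) (root b) ∈Φ) → ∀ w w′ →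
                  Commute (X (lin (+ i) (+ suc j) (root a) (root b)) w) (X (lin (+ k) (+ l) (root a) (root b)) w′)
      T-commute i j k l ∉Φ = X-commute
        (λ eq → lin≢0 ind (+ (i ℕ.+ k)) (+ (suc j ℕ.+ l)) (λ ()) (trans (sym sum) eq))
        (λ { (g , eq) → ∉Φ (g , trans eq sum) })
        where sum = lin-+ (+ i) (+ suc j) (+ k) (+ l) (root a) (root b)

      Absent : ℕ → ℕ → Set
      Absent i j = ¬ (lin (+ i) (+ j) (root a) (root b) ∈Φ)

      gone : ∀ i j → Absent i j → ∀ {t u} → T a b t u i j ≡ []
      gone i j ∉Φ {t} {u} = X-nonroot ∉Φ (mono a b t u i j)

      -- In f(t,u) f(-t,-u) the factors of odd total degree cancel.
      T₁₁∈-odd : Absent 3 1 → Absent 2 2 → Absent 1 3 → Absent 3 2 → Absent 2 3 → Absent 3 3 →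
                 ∀ {t u} → V a t → V b u → P (T a b t u 1 1)
      T₁₁∈-odd n31 n22 n13 n32 n23 n33 {t} {u} ha hb = ⊗-cancel₂ (respects eq (∙∈ (f∈ ha hb) (f∈ (V-neg ha) (V-neg hb))))
        where
        -- The factors at 2α+β and α+2β are both kept: for two short roots of G₂ at 120° the Gram
        -- matrix is that of A₂, yet both vectors are roots.
        f : 𝔽 → 𝔽 → Word
        f t u = (T a b t u 1 1 ++ T a b t u 2 1) ++ T a b t u 1 2
        f∈ : ∀ {t u} → V a t → V b u → P (f t u)
        f∈ {t} {u} ha hb = respects (≡⇒≈ (trans (commProd≡ a b t u)
          (trans (cong (λ z → T a b t u 1 1 ++ T a b t u 2 1 ++ z)
            (trans (cong (T a b t u 1 2 ++_)
              (cong₂ _++_ (gone 3 1 n31) (cong₂ _++_ (gone 2 2 n22) (cong₂ _++_ (gone 1 3 n13) (cong₂ _++_ (gone 3 2 n32) (cong (_++ []) (gone 2 3 n23)))))))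
              (++-identityʳ (T a b t u 1 2))))
            (sym (++-assoc (T a b t u 1 1) (T a b t u 2 1) (T a b t u 1 2))))))
          (commProd∈ a+b≢0 ha hb)
        A B′ C′ : Word
        A  = T a b t u 1 1
        B′ = T a b t u 2 1
        C′ = T a b t u 1 2
        f-neg : f (-F t) (-F u) ≈ (A ++ invW B′) ++ invW C′
        f-neg = ≈-cong (≈-cong
          (≡⇒≈ (cong (X _) (trans (mono-neg₁ a b 1 1 t (-F u) (-F t) ([-t]^1 t)) (trans (cong -F_ (mono-neg₂ a b 1 1 t u (-F u) ([-t]^1 u))) (⁻¹-involutive _)))))
          (≈-trans (≡⇒≈ (cong (X _) (trans (mono-cong₁ a b 2 1 t (-F u) (-F t) ([-t]^2 t)) (mono-neg₂ a b 2 1 t u (-F u) ([-t]^1 u))))) (X-neg _ _)))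
          (≈-trans (≡⇒≈ (cong (X _) (trans (mono-neg₁ a b 1 2 t (-F u) (-F t) ([-t]^1 t)) (cong -F_ (mono-cong₂ a b 1 2 t u (-F u) ([-t]^2 u)))))) (X-neg _ _))
        open import Relation.Binary.Reasoning.Setoid (Group.setoid E)
        -- The pairwise sums of the three vectors are 3α+2β, 2α+3β and 3α+3β, all absent, so the
        -- factors commute.
        BA : Commute B′ A
        BA = T-commute 2 0 1 1 n32 (mono a b t u 2 1) (mono a b t u 1 1)
        CA : Commute C′ A
        CA = T-commute 1 1 1 1 n23 (mono a b t u 1 2) (mono a b t u 1 1)
        CB′ : Commute C′ B′
        CB′ = T-commute 1 1 2 1 n33 (mono a b t u 1 2) (mono a b t u 2 1)
        eq : f t u ++ f (-F t) (-F u) ≈ 2 ⊗ A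
        eq = begin
          f t u ++ f (-F t) (-F u)
            ≈⟨ ≈-cong (≈-refl {f t u}) f-neg ⟩
          ((A ++ B′) ++ C′) ++ ((A ++ invW B′) ++ invW C′)
            ≈⟨ cancel-inverse {A ++ B′} {A ++ invW B′} {C′} {invW C′} (commute-∙ʳ {C′} {A} {invW B′} CA (commute-⁻¹ʳ {C′} {B′} CB′)) (invW-inverseʳ C′) ⟩
          (A ++ B′) ++ (A ++ invW B′)
            ≈⟨ cancel-inverse {A} {A} {B′} {invW B′} BA (invW-inverseʳ B′) ⟩
          A ++ A
            ≈⟨ ≡⇒≈ (cong (A ++_) (sym (++-identityʳ A))) ⟩
          2 ⊗ A ∎

      T₁₁∈-acute : 0ℤ ℤ.≤ B a b → ∀ {t u} → V a t → V b u → P (T a b t u 1 1)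
      T₁₁∈-acute 0≤B {t} {u} ha hb = respects (acute-commutator a b a+b≢0 t u 0≤B) (∙∈ (⁻¹∈ ha) (∙∈ (⁻¹∈ hb) (∙∈ ha hb)))

      module _ {A C D : ℤ} (g : Gram a b A C D) where
        -- The pair (k, l) names a root against which the Cartan bound would fail; the inequality
        -- itself is decided by evaluation.
        absent : ∀ i j k l {e} → root e ≡ lin (+ k) (+ l) (root a) (root b) →
          {True (3 ℕ.* ℤ.∣ form A C D (+ k) (+ l) (+ k) (+ l) ∣ ℕ.<? ℤ.∣ + 2 ℤ.* form A C D (+ i) (+ j) (+ k) (+ l) ∣)} →
          Absent i j
        absent i j k l {e} eq {lt} = excluded g (+ i) (+ j) (+ k) (+ l) {e} eq (toWitness lt)

      root-a : root a ≡ lin 1ℤ 0ℤ (root a) (root b)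
      root-a = sym (lin-10 (root a) (root b))

      root-b : root b ≡ lin 0ℤ 1ℤ (root a) (root b)
      root-b = sym (lin-01 (root a) (root b))

      T₁₁∈-A₂ : Gram a b 1ℤ -1ℤ 1ℤ → ∀ {t u} → V a t → V b u → P (T a b t u 1 1)
      T₁₁∈-A₂ g = T₁₁∈-odd
        (absent g 3 1 1 0 {a} root-a) (absent g 2 2 1 1 {d} root-d) (absent g 1 3 0 1 {b} root-b)
        (absent g 3 2 1 0 {a} root-a) (absent g 2 3 0 1 {b} root-b) (absent g 3 3 1 1 {d} root-d)

      T₁₁∈-B₂ : Gram a b 1ℤ (ℤ.- + 2) (+ 2) → ∀ {t u} → V a t → V b u → P (T a b t u 1 1)
      T₁₁∈-B₂ g = T₁₁∈-odd
        (absent g 3 1 1 0 {a} root-a) (absent g 2 2 1 1 {d} root-d) (absent g 1 3 0 1 {b} root-b)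
        (absent g 3 2 1 1 {d} root-d) (absent g 2 3 0 1 {b} root-b) (absent g 3 3 1 1 {d} root-d)

      module TypeG₂ (g : Gram a b 1ℤ (ℤ.- + 3) (+ 3)) where

        -- In units of q, 2(α, α+β) = 2 - 3 = -1; this is what makes 2α+β a root.
        B-ad<0 : B a d ℤ.< 0ℤ
        B-ad<0 = ℤₚ.*-cancelˡ-<-nonNeg (+ 2) (subst (ℤ._< 0ℤ) (sym (B-form g {1ℤ} {0ℤ} {1ℤ} {1ℤ} {a} {d} root-a root-d))
          (ℤₚ.*-monoˡ-<-neg -1ℤ (Gram.q>0 g)))

        lin-21 : root a +v root d ≡ lin (+ 2) (+ 1) (root a) (root b)
        lin-21 = trans (cong₂ _+v_ root-a root-d) (lin-+ 1ℤ 0ℤ 1ℤ 1ℤ (root a) (root b))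

        e∈Φ : (root a +v root d) ∈Φ
        e∈Φ = sum-root a d B-ad<0 λ d≡-a → lin≢0 ind (+ 2) (+ 1) (λ ())
          (trans (sym lin-21) (trans (cong (root a +v_) d≡-a) (+v-inverseʳ (root a))))

        e : Fin N
        e = proj₁ e∈Φ

        root-e : root e ≡ lin (+ 2) (+ 1) (root a) (root b)
        root-e = trans (proj₂ e∈Φ) lin-21

        0≤B-ed : 0ℤ ℤ.≤ B e d
        0≤B-ed = ℤₚ.*-cancelˡ-≤-pos 0ℤ (B e d) (+ 2) (subst (0ℤ ℤ.≤_)
          (sym (trans (B-form g {+ 2} {1ℤ} {1ℤ} {1ℤ} {e} {d} root-e root-d) (ℤₚ.*-identityˡ (Gram.q g)))) (ℤₚ.<⇒≤ (Gram.q>0 g)))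

        lin-32 : lin 1ℤ 1ℤ (root e) (root d) ≡ lin (+ 3) (+ 2) (root a) (root b)
        lin-32 = trans (cong₂ (lin 1ℤ 1ℤ) root-e root-d) (lin-lin 1ℤ 1ℤ (+ 2) 1ℤ 1ℤ 1ℤ (root a) (root b))

        e+d≢0 : root e +v root d ≢ 0v
        e+d≢0 eq = lin≢0 ind (+ 3) (+ 2) (λ ()) (trans (sym lin-32) (trans (sym (+v≡lin (root e) (root d))) eq))

        -- 2α+β and α+β form an acute pair, so their commutator is a single factor at 3α+2β. Its
        -- parameter is left existential since the factor cancels in `fourth∈`.
        X₂₁X₁₁ : ∀ v w → ∃ λ z → X (lin (+ 2) (+ 1) (root a) (root b)) v ++ X (lin 1ℤ 1ℤ (root a) (root b)) w
          ≈ (X (lin 1ℤ 1ℤ (root a) (root b)) w ++ X (lin (+ 2) (+ 1) (root a) (root b)) v) ++ X (lin (+ 3) (+ 2) (root a) (root b)) z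
        X₂₁X₁₁ v w = mono e d v w 1 1 ,
          subst₂ (λ y z → y ++ z ≈ (z ++ y) ++ X (lin (+ 3) (+ 2) (root a) (root b)) (mono e d v w 1 1))
            (sym (X-root root-e v)) (sym (X-root root-d w))
            (commutator⇒ {x e v} {x d w} (subst (λ z → commW e d v w ≈ X z (mono e d v w 1 1)) lin-32 (acute-commutator e d e+d≢0 v w 0≤B-ed)))

        f : 𝔽 → 𝔽 → Word
        f t u = ((T a b t u 1 1 ++ T a b t u 2 1) ++ T a b t u 3 1) ++ T a b t u 3 2

        f∈ : ∀ {t u} → V a t → V b u → P (f t u)
        f∈ {t} {u} ha hb = respects (≡⇒≈ (trans (commProd≡ a b t u)
          (trans (cong (λ z → T a b t u 1 1 ++ T a b t u 2 1 ++ z)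
            (cong₂ _++_ (gone 1 2 (absent g 1 2 1 0 {a} root-a)) (cong (T a b t u 3 1 ++_)
              (cong₂ _++_ (gone 2 2 (absent g 2 2 1 1 {d} root-d)) (cong₂ _++_ (gone 1 3 (absent g 1 3 1 0 {a} root-a))
                (trans (cong (T a b t u 3 2 ++_) (cong (_++ []) (gone 2 3 (absent g 2 3 1 0 {a} root-a)))) (++-identityʳ (T a b t u 3 2))))))))
            (trans (sym (++-assoc (T a b t u 1 1) (T a b t u 2 1) _)) (sym (++-assoc (T a b t u 1 1 ++ T a b t u 2 1) (T a b t u 3 1) _))))))
          (commProd∈ a+b≢0 ha hb)

        -- The sign changes give f(t,u)f(-t,-u) = LZ and f(t,-u)f(-t,u) = L⁻¹Z, where `L` collects
        -- the squares at α+β and 3α+β. The same `Z` occurs in both, so the quotient is L².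
        fourth∈ : ∀ {t u} → V a t → V b u → P (4 ⊗ T a b t u 1 1 ++ 4 ⊗ T a b t u 3 1)
        fourth∈ {t} {u} ha hb = respects final (∙∈ (respects K₁ (∙∈ (f∈ ha hb) (f∈ (V-neg ha) (V-neg hb))))
                                            (⁻¹∈ (respects K₂ (∙∈ (f∈ ha (V-neg hb)) (f∈ (V-neg ha) hb)))))
          where
          A B′ C′ D Z L : Word
          A  = T a b t u 1 1
          B′ = T a b t u 2 1
          C′ = T a b t u 3 1
          D  = T a b t u 3 2
          Z = X (lin (+ 3) (+ 2) (root a) (root b)) (proj₁ (X₂₁X₁₁ (mono a b t u 2 1) (mono a b t u 1 1)))
          L = (A ++ A) ++ (C′ ++ C′)
          ba : B′ ++ A ≈ (A ++ B′) ++ Z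
          ba = proj₂ (X₂₁X₁₁ (mono a b t u 2 1) (mono a b t u 1 1))
          -- These are the sums of two distinct vectors among those of `A`, `B′`, `C′`, `D`, apart
          -- from the sum for `A` and `B′`. Their absence leaves `A`, `B′` as the only pair that may
          -- fail to commute.
          n42 = absent g 4 2 2 1 {e} root-e
          n43 = absent g 4 3 1 1 {d} root-d
          n52 = absent g 5 2 1 0 {a} root-a
          n53 = absent g 5 3 1 1 {d} root-d
          n63 = absent g 6 3 2 1 {e} root-e
          ac : Commute A C′
          ac = T-commute 1 0 3 1 n42 _ _
          bc : Commute B′ C′
          bc = T-commute 2 0 3 1 n52 _ _
          az : Commute A Z
          az = T-commute 1 0 3 2 n43 _ _
          bz : Commute B′ Z
          bz = T-commute 2 0 3 2 n53 _ _
          cz : Commute C′ Z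
          cz = T-commute 3 0 3 2 n63 _ _
          da : Commute D A
          da = T-commute 3 1 1 1 n43 _ _
          db : Commute D B′
          db = T-commute 3 1 2 1 n53 _ _
          dc : Commute D C′
          dc = T-commute 3 1 3 1 n63 _ _
          A⁻ B⁻ C⁻ : Word
          A⁻ = invW A
          B⁻ = invW B′
          C⁻ = invW C′
          inverseˡ : ∀ v w → Commute v w → Commute (invW v) w
          inverseˡ v w vw = ≈-sym (commute-⁻¹ʳ {w} {v} (≈-sym vw))
          inverseʳ : ∀ v w → Commute v w → Commute v (invW w)
          inverseʳ v w = commute-⁻¹ʳ {v} {w}
          f₋₋ : f (-F t) (-F u) ≈ ((A ++ B⁻) ++ C′) ++ invW D
          f₋₋ = ≈-cong (≈-cong (≈-cong
            (≡⇒≈ (cong (X _) (trans (mono-neg₁ a b 1 1 t (-F u) (-F t) ([-t]^1 t)) (trans (cong -F_ (mono-neg₂ a b 1 1 t u (-F u) ([-t]^1 u))) (⁻¹-involutive _)))))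
            (≈-trans (≡⇒≈ (cong (X _) (trans (mono-cong₁ a b 2 1 t (-F u) (-F t) ([-t]^2 t)) (mono-neg₂ a b 2 1 t u (-F u) ([-t]^1 u))))) (X-neg _ _)))
            (≡⇒≈ (cong (X _) (trans (mono-neg₁ a b 3 1 t (-F u) (-F t) ([-t]^3 t)) (trans (cong -F_ (mono-neg₂ a b 3 1 t u (-F u) ([-t]^1 u))) (⁻¹-involutive _))))))
            (≈-trans (≡⇒≈ (cong (X _) (trans (mono-neg₁ a b 3 2 t (-F u) (-F t) ([-t]^3 t)) (cong -F_ (mono-cong₂ a b 3 2 t u (-F u) ([-t]^2 u)))))) (X-neg _ _))
          f₊₋ : f t (-F u) ≈ ((A⁻ ++ B⁻) ++ C⁻) ++ D
          f₊₋ = ≈-cong (≈-cong (≈-cong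
            (≈-trans (≡⇒≈ (cong (X _) (mono-neg₂ a b 1 1 t u (-F u) ([-t]^1 u)))) (X-neg _ _))
            (≈-trans (≡⇒≈ (cong (X _) (mono-neg₂ a b 2 1 t u (-F u) ([-t]^1 u)))) (X-neg _ _)))
            (≈-trans (≡⇒≈ (cong (X _) (mono-neg₂ a b 3 1 t u (-F u) ([-t]^1 u)))) (X-neg _ _)))
            (≡⇒≈ (cong (X _) (mono-cong₂ a b 3 2 t u (-F u) ([-t]^2 u))))
          f₋₊ : f (-F t) u ≈ ((A⁻ ++ B′) ++ C⁻) ++ invW D
          f₋₊ = ≈-cong (≈-cong (≈-cong
            (≈-trans (≡⇒≈ (cong (X _) (mono-neg₁ a b 1 1 t u (-F t) ([-t]^1 t)))) (X-neg _ _))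
            (≡⇒≈ (cong (X _) (mono-cong₁ a b 2 1 t u (-F t) ([-t]^2 t)))))
            (≈-trans (≡⇒≈ (cong (X _) (mono-neg₁ a b 3 1 t u (-F t) ([-t]^3 t)))) (X-neg _ _)))
            (≈-trans (≡⇒≈ (cong (X _) (mono-neg₁ a b 3 2 t u (-F t) ([-t]^3 t)))) (X-neg _ _))
          module Plus = G₂Product {A} {B′} {C′} {Z} ba ac bc az bz cz
          module Minus = G₂Product {A⁻} {B⁻} {C⁻} {Z} Plus.ba-inverse
            (inverseʳ A⁻ C′ (inverseˡ A C′ ac)) (inverseʳ B⁻ C′ (inverseˡ B′ C′ bc))
            (inverseˡ A Z az) (inverseˡ B′ Z bz) (inverseˡ C′ Z cz)
          K₁ : f t u ++ f (-F t) (-F u) ≈ L ++ Z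
          K₁ = ≈-trans (≈-cong (≈-refl {f t u}) f₋₋)
            (Plus.product {B⁻} {D} {invW D} (invW-inverseʳ B′) (invW-inverseʳ D) (≈-sym (inverseˡ B′ C′ bc)) da (inverseʳ D B′ db) dc)
          K₂ : f t (-F u) ++ f (-F t) u ≈ invW L ++ Z
          K₂ = ≈-trans (≈-cong f₊₋ f₋₊) (≈-trans
            (Minus.product {B′} {D} {invW D} (invW-inverseˡ B′) (invW-inverseʳ D) (inverseˡ C′ B′ (≈-sym bc))
              (inverseʳ D A da) db (inverseʳ D C′ dc))
            (≈-cong (squares-inverse {A} {C′} ac) ≈-refl))
          zl : Commute L Z
          zl = ≈-sym (commute-∙ʳ {Z} (commute-∙ʳ {Z} (≈-sym az) (≈-sym az)) (commute-∙ʳ {Z} (≈-sym cz) (≈-sym cz)))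
          final : (L ++ Z) ++ invW (invW L ++ Z) ≈ 4 ⊗ A ++ 4 ⊗ C′
          final = ≈-trans (quotient-square {L} {Z} zl) (fourth-powers {A} {C′} ac)

        -- Replacing t by 2t scales T₁₁ by 2 and T₃₁ by 8, which separates the two.
        T₁₁∈ : ∀ {t u} → V a t → V b u → P (T a b t u 1 1)
        T₁₁∈ {t} {u} ha hb = ⊗-cancel₂₄ (respects (eliminate {A} {C′} ac) (∙∈ (×∈ 8 (fourth∈ ha hb)) (⁻¹∈ doubled)))
          where
          A C′ : Word
          A  = T a b t u 1 1
          C′ = T a b t u 3 1
          ac : Commute A C′
          ac = T-commute 1 0 3 1 (absent g 4 2 2 1 {e} root-e) (mono a b t u 1 1) (mono a b t u 3 1)
          double : ∀ i j → T a b (scal [ 2 ] t) u i j ≈ (2 ℕ.^ i) ⊗ T a b t u i j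
          double i j = ≈-trans (≡⇒≈ (cong (X _) (mono-scal a b i j t u 2))) (X-scal _ (2 ℕ.^ i) _)
          doubled : P (4 ⊗ (2 ⊗ A) ++ 4 ⊗ (8 ⊗ C′))
          doubled = respects (≈-cong (×-congʳ 4 (double 1 1)) (×-congʳ 4 (double 3 1))) (fourth∈ (V-scal 2 ha) hb)

      C₁₁ : C (root a) (root b) 1 1 ≡ ℤ.- Nc (root b) (root a)
      C₁₁ = cong ℤ.-_ (trans (ℤₚ.*-identityˡ _) (cong (Nc (root b)) (zeroes (root b) (root a))))
        where
        zeroes : ∀ {n} (u v : ZVec n) → ((+ 0) ·v u) +v v ≡ v
        zeroes []      []      = refl
        zeroes (i ∷ u) (j ∷ v) = cong₂ _∷_ (trans (cong (ℤ._+ j) (ℤₚ.*-zeroˡ i)) (ℤₚ.+-identityˡ j)) (zeroes u v)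

      -- The structure constant is -N(β,α) = ±(r+1), and `string<3` makes r+1 at most 3, hence
      -- invertible modulo `p`. The sign stays undetermined, which is harmless since `V` is closed
      -- under negation.
      mono₁₁ : ∀ t u → ∃ λ r → r < 3 × (mono a b t u 1 1 ≡ scal [ suc r ] (t *F u) ⊎ mono a b t u 1 1 ≡ -F (scal [ suc r ] (t *F u)))
      mono₁₁ t u with Nc-value b a (subst (_∈Φ) (+v-comm (root a) (root b)) a+b∈Φ)
      ... | r , string , _ , value = r , string<3 {b} {a} r (subst (_∈Φ) (+v-comm (root a) (root b)) a+b∈Φ) string , sign value
        where
        simplify : ∀ c → (constF [ c ] *F (t ^F 1)) *F (u ^F 1) ≡ scal [ c ] (t *F u)
        simplify c = begin
          (constF [ c ] *F (t ^F 1)) *F (u ^F 1)  ≡⟨ cong₂ (λ y z → (constF [ c ] *F y) *F z) (*F-identityʳ t) (*F-identityʳ u) ⟩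
          (constF [ c ] *F t) *F u                ≡⟨ cong (_*F u) (constF-* p m fl [ c ] t) ⟩
          scal [ c ] t *F u                       ≡⟨ *F-scalˡ [ c ] t u ⟩
          scal [ c ] (t *F u)                     ∎
          where open ≡-Reasoning
        sign : Nc (root b) (root a) ≡ + suc r ⊎ Nc (root b) (root a) ≡ ℤ.- (+ suc r) →
               mono a b t u 1 1 ≡ scal [ suc r ] (t *F u) ⊎ mono a b t u 1 1 ≡ -F (scal [ suc r ] (t *F u))
        sign (inj₁ eq) = inj₂ (begin
          mono a b t u 1 1                                        ≡⟨ mono≡ a b t u 1 1 ⟩
          (ι (C (root a) (root b) 1 1) *F (t ^F 1)) *F (u ^F 1)   ≡⟨ cong (λ z → (ι z *F (t ^F 1)) *F (u ^F 1)) (trans C₁₁ (cong ℤ.-_ eq)) ⟩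
          ((-F constF [ suc r ]) *F (t ^F 1)) *F (u ^F 1)         ≡⟨ cong (_*F (u ^F 1)) (*F-negˡ (constF [ suc r ]) (t ^F 1)) ⟩
          (-F (constF [ suc r ] *F (t ^F 1))) *F (u ^F 1)         ≡⟨ *F-negˡ (constF [ suc r ] *F (t ^F 1)) (u ^F 1) ⟩
          -F ((constF [ suc r ] *F (t ^F 1)) *F (u ^F 1))         ≡⟨ cong -F_ (simplify (suc r)) ⟩
          -F (scal [ suc r ] (t *F u))                            ∎)
          where open ≡-Reasoning
        sign (inj₂ eq) = inj₁ (trans (mono≡ a b t u 1 1) (trans (cong (λ z → (ι z *F (t ^F 1)) *F (u ^F 1)) (trans C₁₁ (cong ℤ.-_ eq))) (simplify (suc r))))

      T₁₁⇒product : ∀ {t u} → P (T a b t u 1 1) → V d (t *F u)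
      T₁₁⇒product {t} {u} h = conclude (mono₁₁ t u)
        where
        h′ : V d (mono a b t u 1 1)
        h′ = subst P (X-root root-d (mono a b t u 1 1)) h
        scaled : ∀ {v} → mono a b t u 1 1 ≡ v ⊎ mono a b t u 1 1 ≡ -F v → V d v
        scaled (inj₁ eq) = subst (V d) eq h′
        scaled (inj₂ eq) = subst (V d) (trans (cong -F_ eq) (⁻¹-involutive _)) (V-neg h′)
        conclude : (∃ λ r → r < 3 × (mono a b t u 1 1 ≡ scal [ suc r ] (t *F u) ⊎ mono a b t u 1 1 ≡ -F (scal [ suc r ] (t *F u)))) → V d (t *F u)
        conclude (r , r<3 , value) = ×-cancel pr (x-torsion d (t *F u)) (suc r) (ℕₚ.≤-<-trans r<3 3<p)
          (respects (x-scal d (suc r) (t *F u)) (scaled value))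

    product∈ : ∀ {a b c} → root c ≡ root a +v root b → ∀ {t u} → V a t → V b u → V c (t *F u)
    product∈ {a} {b} {c} c≡a+b {t} {u} ha hb = by-angle (angle a b (sum⇒independent c∈))
      where
      c∈ : (root a +v root b) ∈Φ
      c∈ = c , c≡a+b
      c∈′ : (root b +v root a) ∈Φ
      c∈′ = c , trans c≡a+b (+v-comm (root a) (root b))
      by-angle : Angle a b → V c (t *F u)
      by-angle (acute 0≤B) = Pair.T₁₁⇒product {a} {b} c∈ (Pair.T₁₁∈-acute {a} {b} c∈ 0≤B ha hb)
      by-angle (A₂ g)      = Pair.T₁₁⇒product {a} {b} c∈ (Pair.T₁₁∈-A₂ {a} {b} c∈ g ha hb)
      by-angle (B₂ g)      = Pair.T₁₁⇒product {a} {b} c∈ (Pair.T₁₁∈-B₂ {a} {b} c∈ g ha hb)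
      by-angle (G₂ g)      = Pair.T₁₁⇒product {a} {b} c∈ (Pair.TypeG₂.T₁₁∈ {a} {b} c∈ g ha hb)
      -- The second root is the short one here, so the pair is exchanged and `*F-comm` restores the
      -- order of the parameters.
      by-angle (B₂′ g)     = subst (V c) (*F-comm u t) (Pair.T₁₁⇒product {b} {a} c∈′ (Pair.T₁₁∈-B₂ {b} {a} c∈′ g hb ha))
      by-angle (G₂′ g)     = subst (V c) (*F-comm u t) (Pair.T₁₁⇒product {b} {a} c∈′ (Pair.TypeG₂.T₁₁∈ {b} {a} c∈′ g hb ha))

  -- The subgroup X_S

  module Generated (s : Fin (suc n) → Fin N) where

    Good : Letter → Set
    Good l = Σ (Fin (suc n)) λ k → proj₁ (proj₂ l) ≡ s k × Deg≤1 (proj₂ (proj₂ l))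

    X-S : Word → Set
    X-S w = Σ Word λ w′ → All Good w′ × w′ ≈ w

    invW-good : ∀ {w} → All Good w → All Good (invW w)
    invW-good []                      = []
    invW-good {(true , _) ∷ _}  (l ∷ ls) = Allₚ.++⁺ (invW-good ls) (l ∷ [])
    invW-good {(false , _) ∷ _} (l ∷ ls) = Allₚ.++⁺ (invW-good ls) (l ∷ [])

    X-S-isSubgroup : IsSubgroup X-S
    X-S-isSubgroup = record
      { respects = λ { a≈b (w , good , w≈a) → w , good , ≈-trans w≈a a≈b }
      ; ε∈  = [] , [] , ≈-refl
      ; ∙∈  = λ { (v , gv , v≈) (w , gw , w≈) → v ++ w , Allₚ.++⁺ gv gw , ≈-cong v≈ w≈ }
      ; ⁻¹∈ = λ { (w , gw , w≈) → invW w , invW-good gw , invW-cong w≈ }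
      }

    open IsSubgroup X-S-isSubgroup

    deg≤1∈ : PosClosureIsΦ s → ∀ a t → Deg≤1 t → V X-S-isSubgroup a t
    deg≤1∈ closure a = peel s (λ a → ∀ t → Deg≤1 t → V X-S-isSubgroup a t)
      (λ k t deg → x (s k) t , (k , refl , deg) ∷ [] , ≈-refl)
      -- The summand contributes the parameter 1, so the product of the parameters is again `t` and
      -- the degree does not grow.
      (λ {a} {c} k a≡c+s hc t deg → subst (V X-S-isSubgroup a) (*F-identityʳ t)
        (product∈ X-S-isSubgroup {c} {s k} {a} a≡c+s (hc t deg) (x (s k) 1F , (k , refl , Deg≤1-1F p m fl) ∷ [] , ≈-refl)))
      (sumℕ (proj₁ (closure a))) (proj₁ (closure a)) a refl (proj₂ (closure a))

    -- An element lying in V a for all a may be multiplied by x, because every root is a sum of two roots.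
    all∈ : (X : 𝔽) → (∀ u → X *F u ≡ mulX fl u) → (∀ a → V X-S-isSubgroup a X) → (∀ a → V X-S-isSubgroup a 1F) →
           (∀ a → ∃₂ λ b c → root a ≡ root b +v root c) → ∀ a t → V X-S-isSubgroup a t
    all∈ X X* X∈ 1∈ split a t = subst (V X-S-isSubgroup a) (*F-identityʳ t) (horner∈ t a)
      where
      -- Membership is proved for all roots at once, because the tail is needed at the summand `e`
      -- of `a` rather than at `a`. The constant coefficient enters as a multiple of 1.
      horner∈ : ∀ {k} (v : Vec (Fin p) k) a → V X-S-isSubgroup a (horner v 1F)
      horner∈ []      a = respects (≈-sym (x-0 a)) ε∈
      horner∈ (c ∷ v) a with split a | []-surjective c
      ... | b , e , a≡b+e | k , refl = V-+ X-S-isSubgroup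
        (subst (V X-S-isSubgroup a) (X* (horner v 1F)) (product∈ X-S-isSubgroup {b} {e} {a} a≡b+e (X∈ b) (horner∈ v e)))
        (V-scal X-S-isSubgroup k (1∈ a))

theorem3p8 : (p : ℕ) .{{_ : NonZero p}} → Prime p → 3 < p →
    (m : ℕ) → 1 ≤ m → (fl : Vec (Fin p) m) → Poly.IrreducibleMonic p fl →
    (n : ℕ) → 2 ≤ n → (R : RootSystem n) → (CB : ChevalleyBasis R) →
    (s : Fin (suc n) → Fin (RootSystem.N R)) → Injective _≡_ _≡_ s →
    RS.PosClosureIsΦ R s →
    Chevalley.X-S≡E p m fl R CB s
-- For m = 1 no index reaches 2, so every element has degree at most 1 and peeling alone suffices.
theorem3p8 p pr 3<p (suc zero) _ fl _ n _ R CB s _ closure a t =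
  Closure.Generated.deg≤1∈ p pr 3<p 1 fl R CB s closure a t (λ { Fin.zero () })
-- With n ≥ 2 the injective `s` has at least three values, as `two-summands` requires.
theorem3p8 p pr 3<p (suc (suc m)) _ fl _ (suc (suc n)) _ R CB s s-inj closure with *-X p m fl
... | X , deg-X , X* = all∈ X X* (λ a → deg≤1∈ closure a X deg-X) (λ a → deg≤1∈ closure a _ (Deg≤1-1F p (2 ℕ.+ m) fl))
                         (RootGeometry.two-summands R s s-inj)
  where open Closure.Generated p pr 3<p (2 ℕ.+ m) fl R CB s
theorem3p8 _ _ _ (suc (suc _)) _ _ _ (suc zero) (s≤s ())
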